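{- There is an absolute constant $a>0$ such that the following holds. Let $P$ be any multi-DB protocol. Then for all integers $n\ge4$, $3\le D\le n/6$ and $2\le c\le r$, there exist an $n$-node directed graph $G^P$ with maximum eccentricity $D$ and maximum in-degree $\Delta=2$, and a set of $r$ independent broadcast operations on $G^P$ yielding congestion $c$, such that the completion time of $P$ for these operations on $G^P$ is at least $$a\left(c+\Big(\frac{c}{\log_2 c}+D\Big)\log_2 n\right).$$
   Context: A (radio) network is a directed graph whose $n$ nodes have distinct labels in $\{1,\dots,n\}$; an edge $(u,v)$ means $u$ can transmit to $v$ in one hop. An $r$-broadcast operation is a set of $r$ independent broadcasts: $r$ distinct broadcast messages (with unique IDs) initially reside at source nodes (an arbitrary multiset of nodes), and each must be received by all nodes reachable from its source. A multi-DB protocol works in time-slots $0,1,2,\dots$: (1) in each slot each node acts either as a transmitter, sending one message along all outgoing edges, or as a receiver; (2) all nodes share the same message-recovering function $\mathcal R$, which takes a transmitted message $m$ and returns the unique broadcast message contained in $m$, if any (so each transmission carries at most one broadcast message; bounded-bandwidth model); (3) a node receives a message in a slot if and only if it acts as a receiver and exactly one of its in-neighbours acts as a transmitter in that slot; otherwise it receives nothing; (4) the action of a node in a slot is a deterministic function of its own label, the slot number, and the messages it received in previous slots (a source also initially knows its own broadcast messages). A node has received broadcast message $z$ once it has received some $m$ with $\mathcal R(m)=z$. The completion time is the least $t$ such that within the first $t$ slots every broadcast message has been received by all nodes reachable from its source. The congestion $c$ is the maximum, over nodes $v$, of the number of broadcast messages $v$ has to receive, i.e. those whose source is a node other than $v$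 from which $v$ is reachable. The eccentricity of a node is its largest distance to a node reachable from it; the maximum eccentricity $D$ is the maximum over possible source nodes. -}

module Defs where

open import Data.Fin using (Fin; toℕ)
import Data.Fin.Properties as Fin
open import Data.Fin.Subset using (Subset; _∈_; ∣_∣)
open import Data.Integer as ℤ using (+_)
open import Data.List as List using (List; []; _∷_; allFin; filter; mapMaybe)
open import Data.Maybe using (Maybe; just; nothing)
import Data.Maybe.Relation.Unary.Any as Maybe
open import Data.Nat using (ℕ; zero; suc; _≤_; _^_)
open import Data.Product using (Σ; ∃; _×_)
open import Data.Rational as ℚ using (ℚ; ↥_; ↧ₙ_; Positive)
open import Data.Rational.Properties using (pos⇒nonZero)
open import Data.Vec as Vec using (Vec)
import Data.Vec.Relation.Unary.Any as Vec
open import Function.Bundles using (_⇔_)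
open import Function.Definitions using (Injective)
open import Level using (0ℓ)
open import Relation.Binary.Core using (Rel)
open import Relation.Binary.Construct.Closure.ReflexiveTransitive using (Star; fold)
open import Relation.Binary.Definitions using (Decidable)
open import Relation.Binary.PropositionalEquality using (_≡_; _≢_)
open import Relation.Nullary using (¬_)

IsLeast : (ℕ → Set) → ℕ → Set
IsLeast P m = P m × (∀ k → P k → m ≤ k)

IsGreatest : (ℕ → Set) → ℕ → Set
IsGreatest P m = P m × (∀ k → P k → k ≤ m)

HasCardinality : ∀ {n} → (Fin n → Set) → ℕ → Set
HasCardinality {n} P k = Σ (Subset n) λ S → (∀ i → i ∈ S ⇔ P i) × ∣ S ∣ ≡ k

record Digraph (n : ℕ) : Set₁ where
  field
    _⟶_      : Rel (Fin n) 0ℓ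
    _⟶?_     : Decidable _⟶_
    loopless : ∀ v → ¬ (v ⟶ v)

module _ {n : ℕ} (G : Digraph n) where
  open Digraph G

  Walk : Rel (Fin n) 0ℓ
  Walk = Star _⟶_

  length : ∀ {u v} → Walk u v → ℕ
  length = fold (λ _ _ → ℕ) (λ _ k → suc k) 0

  Distance : Fin n → Fin n → ℕ → Set
  Distance u v = IsLeast (λ k → Σ (Walk u v) λ p → length p ≡ k)

  Eccentricity : Fin n → ℕ → Set
  Eccentricity u = IsGreatest (λ d → ∃ λ v → Distance u v d)

  -- Sources of broadcasts are unrestricted, so every node is a possible source.
  MaxEccentricity : ℕ → Set
  MaxEccentricity = IsGreatest (λ e → ∃ λ u → Eccentricity u e)

  InDegree : Fin n → ℕ → Set
  InDegree v = HasCardinality (λ u → u ⟶ v)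

  MaxInDegree : ℕ → Set
  MaxInDegree = IsGreatest (λ d → ∃ λ v → InDegree v d)

-- Broadcast messages are identified with their IDs.
BroadcastMessage : Set
BroadcastMessage = ℕ

data Action (M : Set) : Set where
  transmit : M → Action M
  receive  : Action M

record Protocol : Set₁ where
  field
    Message : Set
    recover : Message → Maybe BroadcastMessage
    -- The vector records what was heard in slots t-1, …, 1, 0 (latest first),
    -- with `nothing` for a slot in which nothing was received.
    act     : (label : ℕ) (own : List BroadcastMessage)
              (t : ℕ) → Vec (Maybe Message) t → Action Message

record Broadcasts (n r : ℕ) : Set where
  field
    message  : Fin r → BroadcastMessage
    source   : Fin r → Fin n
    distinct : Injective _≡_ _≡_ message

  own : Fin n → List BroadcastMessage
  own v = List.map message (filter (λ i → source i Fin.≟ v) (allFin r))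

module _ {n r : ℕ} (G : Digraph n) (B : Broadcasts n r) where
  open Broadcasts B

  HasToReceive : Fin n → Fin r → Set
  HasToReceive v i = source i ≢ v × Walk G (source i) v

  Congestion : ℕ → Set
  Congestion = IsGreatest (λ k → ∃ λ v → HasCardinality (HasToReceive v) k)

transmitted : ∀ {M} → Action M → Maybe M
transmitted (transmit m) = just m
transmitted receive      = nothing

sole : ∀ {A : Set} → List A → Maybe A
sole (x ∷ []) = just x
sole _        = nothing

module _ {n : ℕ} (G : Digraph n) where
  open Digraph G

  hears : ∀ {M} → (Fin n → Action M) → Fin n → Maybe M
  hears acts v with acts v
  ... | transmit _ = nothing
  ... | receive    =
    sole (mapMaybe (λ u → transmitted (acts u)) (filter (_⟶? v) (allFin n)))

module _ (P : Protocol) {n r : ℕ} (G : Digraph n) (B : Broadcasts n r) where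
  open Protocol P
  open Broadcasts B

  -- `Fin n` counts from 0 whereas labels are 1, …, n.
  label : Fin n → ℕ
  label v = suc (toℕ v)

  -- What each node heard in slots 0, …, t-1.
  history : (t : ℕ) → Fin n → Vec (Maybe Message) t
  history zero    v = Vec.[]
  history (suc t) v =
    hears G (λ u → act (label u) (own u) t (history t u)) v Vec.∷ history t v

  ReceivedWithin : ℕ → Fin n → BroadcastMessage → Set
  ReceivedWithin t v z =
    Vec.Any (Maybe.Any (λ m → recover m ≡ just z)) (history t v)

  CompletedWithin : ℕ → Set
  CompletedWithin t =
    ∀ v i → HasToReceive G B v i → ReceivedWithin t v (message i)

  -- A protocol that never completes has no completion time; lower bounds are
  -- stated for every completion time, which treats this case as infinite.
  CompletionTime : ℕ → Set
  CompletionTime = IsLeast CompletedWithin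

infix 4 log₂_≤ᵘ_ _≤ˡlog₂_

-- Comparison of a real logarithm with a positive rational p / q, cleared of
-- denominators: log₂ n ≤ p / q iff n ^ q ≤ 2 ^ p, and dually.
log₂_≤ᵘ_ : ℕ → (s : ℚ) → .{{Positive s}} → Set
log₂ n ≤ᵘ s = n ^ ↧ₙ s ≤ 2 ^ ℤ.∣ ↥ s ∣

_≤ˡlog₂_ : (t : ℚ) → .{{Positive t}} → ℕ → Set
t ≤ˡlog₂ n = 2 ^ ℤ.∣ ↥ t ∣ ≤ n ^ ↧ₙ t

fromℕ : ℕ → ℚ
fromℕ k = + k ℚ./ 1

infixl 7 _÷⁺_

_÷⁺_ : (x s : ℚ) → .{{Positive s}} → ℚ
x ÷⁺ s = (x ℚ.÷ s) {{pos⇒nonZero s}}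

-- The real inequality  a (c + (c / log₂ c + D) log₂ n) ≤ T  for n, c ≥ 2, a > 0.
-- The left side is continuous, decreasing in log₂ c and increasing in log₂ n,
-- both positive, so it is the supremum of its values with log₂ c replaced by
-- rationals s ≥ log₂ c and log₂ n by positive rationals t ≤ log₂ n.
TimeBound : (a : ℚ) (n D c T : ℕ) → Set
TimeBound a n D c T =
  (s t : ℚ) .{{_ : Positive s}} .{{_ : Positive t}} →
  log₂ c ≤ᵘ s → t ≤ˡlog₂ n →
  a ℚ.* (fromℕ c ℚ.+ (fromℕ c ÷⁺ s ℚ.+ fromℕ D) ℚ.* t) ℚ.≤ fromℕ T

-- The graph is a source s followed by D layers of two nodes each, consecutive layers being completely
-- joined, so that a node of layer i + 2 hears something only if exactly one node of layer i + 1
-- transmits.  The adversary picks each layer after watching how all unused nodes would act in it.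
--
-- D log n: any n/2 candidates contain two with the same transmission pattern over log n - O(1) given
-- slots, so each further layer costs that many slots in which nothing is heard.  A protocol might
-- still guess a message ID; but there are finitely many layerings, so among sufficiently many IDs
-- one is not guessed.
--
-- (c / log c) log n: for a message z, view the slots of a candidate as a string with a hit where it
-- transmits z, silence where it listens, and a free symbol elsewhere.  If the strings of two
-- candidates are compatible, then z does not pass through the layer which they form.  By Kraft's
-- inequality, with hits of probability 1 / 2c, pairwise incompatible strings need many hits; but in
-- c κ slots every candidate transmits some message at most κ times.
--
-- c: a node hears at most one message per slot.

module Submission where

open import Defs
open import Data.Nat
open import Data.Nat.Properties
open import Data.Nat.DivMod using (_/_; _%_; m/n*n≤m; m%n<n; m≡m%n+[m/n]*n)
open import Data.Nat.Tactic.RingSolver using (solve-∀)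
open import Data.Fin using (Fin; zero; suc; toℕ; fromℕ<; inject≤; combine; funToFin; finToFun)
import Data.Fin.Properties as Fin
open import Data.Fin.Subset as Subset using (Subset; ⁅_⁆; _∪_; ∣_∣; inside; outside)
import Data.Fin.Subset.Properties as Subset
import Data.Integer as ℤ
import Data.Integer.Properties as ℤ
open import Data.List as List using (List; []; _∷_; allFin; filter; foldr; mapMaybe)
open import Data.List.Membership.Propositional using (_∈_)
open import Data.List.Membership.Propositional.Properties
  using (∈-allFin; ∈-filter⁺; ∈-filter⁻; ∈-map⁺; ∈-map⁻)
open import Data.List.Properties
  using (filter-all; filter-none; length-map; length-tabulate; ∷-injectiveˡ; ∷-injectiveʳ)
open import Data.List.Relation.Unary.All as All using ([]; _∷_)
open import Data.List.Relation.Unary.AllPairs using ([]; _∷_)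
open import Data.List.Relation.Unary.Any using (here; there)
open import Data.List.Relation.Unary.Unique.Propositional using (Unique)
import Data.List.Relation.Unary.Unique.Propositional.Properties as Unique
open import Data.Maybe using (Maybe; just; nothing)
import Data.Maybe.Properties as Maybe
import Data.Maybe.Relation.Unary.Any as MaybeAny
open import Data.Product using (Σ; ∃; ∃₂; _×_; _,_; proj₁; proj₂)
open import Data.Rational as ℚ using (ℚ; 0ℚ; mkℚ; Positive) renaming (_<_ to _<ℚ_)
import Data.Rational.Properties as ℚ
open import Data.Rational.Unnormalised as ℚᵘ using (mkℚᵘ; *≤*)
import Data.Rational.Unnormalised.Properties as ℚᵘ
open import Data.Sum using (_⊎_; inj₁; inj₂)
open import Data.Unit using (⊤; tt)
open import Data.Vec as Vec using (Vec; []; _∷_)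
import Data.Vec.Relation.Unary.Any as VecAny
open import Function using (_∘_; case_of_; id)
open import Function.Bundles using (_⇔_; mk⇔; Equivalence)
open import Relation.Binary.Construct.Closure.ReflexiveTransitive using (ε; _◅_; _◅◅_)
open import Relation.Binary.Definitions using (DecidableEquality)
open import Relation.Binary.PropositionalEquality
open import Relation.Nullary using (¬_; Dec; yes; no; contradiction)
open import Relation.Nullary.Decidable using (¬?; _×-dec_; _⊎-dec_)
open import Relation.Unary using () renaming (Decidable to Decidable₁)

-- Cardinalities

fromList : ∀ {n} → List (Fin n) → Subset n
fromList = foldr (λ x S → ⁅ x ⁆ ∪ S) Subset.⊥

∈-fromList⁺ : ∀ {n} {x : Fin n} {xs} → x ∈ xs → x Subset.∈ fromList xs
∈-fromList⁺ {xs = y ∷ ys} (here refl) = Subset.p⊆p∪q (fromList ys) (Subset.x∈⁅x⁆ y)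
∈-fromList⁺ {xs = y ∷ ys} (there x∈)  = Subset.q⊆p∪q ⁅ y ⁆ _ (∈-fromList⁺ x∈)

∈-fromList⁻ : ∀ {n} {x : Fin n} xs → x Subset.∈ fromList xs → x ∈ xs
∈-fromList⁻ []       x∈ = contradiction x∈ Subset.∉⊥
∈-fromList⁻ (y ∷ ys) x∈ with Subset.x∈p∪q⁻ ⁅ y ⁆ (fromList ys) x∈
... | inj₁ x∈y  = here (Subset.x∈⁅y⁆⇒x≡y y x∈y)
... | inj₂ x∈ys = there (∈-fromList⁻ ys x∈ys)

∣⁅x⁆∪p∣≤ : ∀ {n} (x : Fin n) p → ∣ ⁅ x ⁆ ∪ p ∣ ≤ suc ∣ p ∣
∣⁅x⁆∪p∣≤ zero    (outside ∷ p) rewrite Subset.∪-identityˡ p = ≤-refl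
∣⁅x⁆∪p∣≤ zero    (inside ∷ p)  rewrite Subset.∪-identityˡ p = n≤1+n _
∣⁅x⁆∪p∣≤ (suc x) (outside ∷ p) = ∣⁅x⁆∪p∣≤ x p
∣⁅x⁆∪p∣≤ (suc x) (inside ∷ p)  = s≤s (∣⁅x⁆∪p∣≤ x p)

∣⁅x⁆∪p∣≡ : ∀ {n} (x : Fin n) p → x Subset.∉ p → ∣ ⁅ x ⁆ ∪ p ∣ ≡ suc ∣ p ∣
∣⁅x⁆∪p∣≡ zero    (outside ∷ p) x∉ rewrite Subset.∪-identityˡ p = refl
∣⁅x⁆∪p∣≡ zero    (inside ∷ p)  x∉ = contradiction Vec.here x∉
∣⁅x⁆∪p∣≡ (suc x) (outside ∷ p) x∉ = ∣⁅x⁆∪p∣≡ x p (x∉ ∘ Vec.there)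
∣⁅x⁆∪p∣≡ (suc x) (inside ∷ p)  x∉ = cong suc (∣⁅x⁆∪p∣≡ x p (x∉ ∘ Vec.there))

∣fromList∣≤ : ∀ {n} (xs : List (Fin n)) → ∣ fromList xs ∣ ≤ List.length xs
∣fromList∣≤ {n} [] = ≤-reflexive (Subset.∣⊥∣≡0 n)
∣fromList∣≤ (x ∷ xs) = ≤-trans (∣⁅x⁆∪p∣≤ x _) (s≤s (∣fromList∣≤ xs))

∣fromList∣≡ : ∀ {n} {xs : List (Fin n)} → Unique xs → ∣ fromList xs ∣ ≡ List.length xs
∣fromList∣≡ {n} [] = Subset.∣⊥∣≡0 n
∣fromList∣≡ {xs = x ∷ xs} (x∉xs ∷ xs!) =
  trans (∣⁅x⁆∪p∣≡ x _ (λ x∈ → All.lookup x∉xs (∈-fromList⁻ xs x∈) refl)) (cong suc (∣fromList∣≡ xs!))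

hasCardinality : ∀ {n} {P : Fin n → Set} xs → Unique xs → (∀ i → i ∈ xs ⇔ P i) →
  HasCardinality P (List.length xs)
hasCardinality xs xs! xs⇔P =
  fromList xs ,
  (λ i → mk⇔ (Equivalence.to (xs⇔P i) ∘ ∈-fromList⁻ xs) (∈-fromList⁺ ∘ Equivalence.from (xs⇔P i))) ,
  ∣fromList∣≡ xs!

cardinality≤ : ∀ {n k} {P : Fin n → Set} xs → (∀ i → P i → i ∈ xs) → HasCardinality P k → k ≤ List.length xs
cardinality≤ xs P⊆xs (S , S⇔P , refl) =
  ≤-trans (Subset.p⊆q⇒∣p∣≤∣q∣ λ {i} i∈S → ∈-fromList⁺ (P⊆xs i (Equivalence.to (S⇔P i) i∈S))) (∣fromList∣≤ xs)

module _ {A : Set} (_≟ᴬ_ : DecidableEquality A) where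

  remove : A → List A → List A
  remove a = filter (λ x → ¬? (x ≟ᴬ a))

  length-remove : ∀ {xs} a → Unique xs → List.length xs ≤ suc (List.length (remove a xs))
  length-remove a [] = z≤n
  length-remove {x ∷ xs} a (x∉xs ∷ xs!) with x ≟ᴬ a
  ... | no  _    = s≤s (length-remove a xs!)
  ... | yes refl = s≤s (≤-reflexive (cong List.length (sym (filter-all (λ y → ¬? (y ≟ᴬ x)) (All.map ≢-sym x∉xs)))))

-- Kraft's inequality

data Symbol : Set where
  hit silent other : Symbol

-- Only a hit paired with silence is excluded: then exactly one of two in-neighbours transmits, and
-- what it sends is the message in question. In every other case there is silence, a collision or a
-- different message.
data Compatible : Symbol → Symbol → Set where
  hits    : Compatible hit hit
  silents : Compatible silent silent
  otherˡ  : ∀ {y} → Compatible other y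
  otherʳ  : ∀ {x} → Compatible x other

silent? : Decidable₁ (_≡ silent)
silent? hit    = no λ ()
silent? silent = yes refl
silent? other  = no λ ()

hit? : Decidable₁ (_≡ hit)
hit? hit    = yes refl
hit? silent = no λ ()
hit? other  = no λ ()

module _ {A : Set} (σ : A → ℕ → Symbol) where

  CompatiblePair : List A → ℕ → Set
  CompatiblePair xs T = ∃₂ λ x y → x ∈ xs × y ∈ xs × x ≢ y × (∀ t → t < T → Compatible (σ x t) (σ y t))

  extend : ∀ {P : A → Set} (P? : Decidable₁ P) {xs T} →
    (∀ {x y} → P x → P y → Compatible (σ x T) (σ y T)) →
    CompatiblePair (filter P? xs) T → CompatiblePair xs (suc T)
  extend P? {xs} {T} compat (x , y , x∈ , y∈ , x≢y , c) =
    let x∈xs , Px = ∈-filter⁻ P? {xs = xs} x∈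
        y∈xs , Py = ∈-filter⁻ P? {xs = xs} y∈
    in x , y , x∈xs , y∈xs , x≢y , λ t t<sT → case m<1+n⇒m<n∨m≡n t<sT of λ where
         (inj₁ t<T)  → c t t<T
         (inj₂ refl) → compat Px Py

-- A string of symbols describes a subcube, `other` leaving a coordinate free, and incompatible
-- strings describe disjoint subcubes.  The weight is (1 + β)^T times the measure of the subcube
-- when a hit has probability 1 / (1 + β).
module Kraft (β : ℕ) where

  factor : Symbol → ℕ
  factor hit    = 1
  factor silent = β
  factor other  = suc β

  weight : (ℕ → Symbol) → ℕ → ℕ
  weight σ zero    = 1
  weight σ (suc t) = factor (σ t) * weight σ t

  module _ {A : Set} (σ : A → ℕ → Symbol) where

    total : List A → ℕ → ℕ
    total []       t = 0
    total (x ∷ xs) t = weight (σ x) t + total xs t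

    audible? : ∀ t → Decidable₁ (λ x → σ x t ≢ silent)
    audible? t x = ¬? (silent? (σ x t))

    missing? : ∀ t → Decidable₁ (λ x → σ x t ≢ hit)
    missing? t x = ¬? (hit? (σ x t))

    -- Coordinate `t` splits the cube into a part with a hit, of share 1, and a part with silence,
    -- of share `β`. A string with `other` meets both parts, hence its factor 1 + `β`.
    total-suc : ∀ xs t → total xs (suc t) ≡
      total (filter (audible? t) xs) t + β * total (filter (missing? t) xs) t
    total-suc [] t = sym (*-zeroʳ β)
    total-suc (x ∷ xs) t with σ x t
    ... | hit    = trans (cong (1 * weight (σ x) t +_) (total-suc xs t)) (lemma (weight (σ x) t) _ _)
      where lemma : ∀ a b c → 1 * a + (b + c) ≡ a + b + c
            lemma = solve-∀
    ... | silent = trans (cong (β * weight (σ x) t +_) (total-suc xs t)) (lemma (weight (σ x) t) _ β _)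
      where lemma : ∀ a b β c → β * a + (b + β * c) ≡ b + β * (a + c)
            lemma = solve-∀
    ... | other  = trans (cong (suc β * weight (σ x) t +_) (total-suc xs t)) (lemma (weight (σ x) t) _ β _)
      where lemma : ∀ a b β c → (1 + β) * a + (b + β * c) ≡ a + b + β * (a + c)
            lemma = solve-∀

    -- By `total-suc`, one of the two parts of the cube is again overfull, and strings that meet the
    -- same part are compatible in slot `T`. After the last slot, overfull means that two entries
    -- are left.
    kraft : ∀ T xs → Unique xs → suc β ^ T < total xs T → CompatiblePair σ xs T
    kraft zero []           xs! ()
    kraft zero (x ∷ [])     xs! (s≤s ())
    kraft zero (x ∷ y ∷ xs) ((x≢y ∷ _) ∷ _) _ = x , y , here refl , there (here refl) , x≢y , λ _ ()
    kraft (suc T) xs xs! big with suc β ^ T <? total (filter (audible? T) xs) T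
    ... | yes big₁ = extend σ (audible? T) compat (kraft T _ (Unique.filter⁺ (audible? T) xs!) big₁)
      where
      compat : ∀ {x y} → σ x T ≢ silent → σ y T ≢ silent → Compatible (σ x T) (σ y T)
      compat {x} {y} p q with σ x T | σ y T
      ... | silent | _      = contradiction refl p
      ... | other  | _      = otherˡ
      ... | hit    | silent = contradiction refl q
      ... | hit    | hit    = hits
      ... | hit    | other  = otherʳ
    ... | no ¬big₁ with suc β ^ T <? total (filter (missing? T) xs) T
    ...   | yes big₂ = extend σ (missing? T) compat (kraft T _ (Unique.filter⁺ (missing? T) xs!) big₂)
      where
      compat : ∀ {x y} → σ x T ≢ hit → σ y T ≢ hit → Compatible (σ x T) (σ y T)
      compat {x} {y} p q with σ x T | σ y T
      ... | hit    | _      = contradiction refl p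
      ... | other  | _      = otherˡ
      ... | silent | hit    = contradiction refl q
      ... | silent | silent = silents
      ... | silent | other  = otherʳ
    ...   | no ¬big₂ = contradiction big (≤⇒≯ (begin
      total xs (suc T)                              ≡⟨ total-suc xs T ⟩
      _ + β * _                                     ≤⟨ +-mono-≤ (≮⇒≥ ¬big₁) (*-monoʳ-≤ β (≮⇒≥ ¬big₂)) ⟩
      suc β ^ T + β * suc β ^ T                     ∎))
      where open ≤-Reasoning

-- Sums and powers

∑< : ℕ → (ℕ → ℕ) → ℕ
∑< zero    f = 0
∑< (suc c) f = f c + ∑< c f

∑<-pigeonhole : ∀ c f M → c * M < ∑< c f → ∃ λ i → i < c × M < f i
∑<-pigeonhole (suc c) f M big with M <? f c
... | yes M<fc = c , ≤-refl , M<fc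
... | no  M≮fc =
  let i , i<c , M<fi = ∑<-pigeonhole c f M (+-cancelˡ-< M _ _ (<-≤-trans big (+-monoˡ-≤ _ (≮⇒≥ M≮fc))))
  in i , m<n⇒m<1+n i<c , M<fi

∑<-pigeonhole-≤ : ∀ c f M → ∑< c f < c * suc M → ∃ λ i → i < c × f i ≤ M
∑<-pigeonhole-≤ (suc c) f M small with f c ≤? M
... | yes fc≤M = c , ≤-refl , fc≤M
... | no  fc≰M =
  let i , i<c , fi≤M = ∑<-pigeonhole-≤ c f M (+-cancelˡ-< (suc M) _ _ (≤-<-trans (+-monoˡ-≤ _ (≰⇒> fc≰M)) small))
  in i , m<n⇒m<1+n i<c , fi≤M

∑<-+ : ∀ c f g → ∑< c (λ i → f i + g i) ≡ ∑< c f + ∑< c g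
∑<-+ zero    f g = refl
∑<-+ (suc c) f g = trans (cong (f c + g c +_) (∑<-+ c f g)) (lemma (f c) (g c) _ _)
  where lemma : ∀ a b x y → a + b + (x + y) ≡ a + x + (b + y)
        lemma = solve-∀

∑<-zero : ∀ c {f} → (∀ i → i < c → f i ≡ 0) → ∑< c f ≡ 0
∑<-zero zero    f≡0 = refl
∑<-zero (suc c) f≡0 rewrite f≡0 c ≤-refl = ∑<-zero c λ i i<c → f≡0 i (m<n⇒m<1+n i<c)

∑<-at-most-one : ∀ c f → (∀ i → f i ≤ 1) → (∀ i j → 0 < f i → 0 < f j → i ≡ j) → ∑< c f ≤ 1
∑<-at-most-one zero    f f≤1 uniq = z≤n
∑<-at-most-one (suc c) f f≤1 uniq with f c in eq
... | zero  = ∑<-at-most-one c f f≤1 uniq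
... | suc m rewrite ∑<-zero c {f} (λ i i<c → n<1⇒n≡0 (≰⇒> λ 0<fi →
        <⇒≢ i<c (uniq i c 0<fi (subst (0 <_) (sym eq) z<s)))) | +-identityʳ m =
  subst (_≤ 1) eq (f≤1 c)

∑<-≥ : ∀ c f i → i < c → f i ≤ ∑< c f
∑<-≥ (suc c) f i i<sc with m<1+n⇒m<n∨m≡n i<sc
... | inj₁ i<c  = ≤-trans (∑<-≥ c f i i<c) (m≤n+m _ _)
... | inj₂ refl = m≤m+n _ _

-- Bernoulli's inequality (1 - 1 / (1 + b))^k ≥ 1 - k / (1 + b), multiplied by (1 + b)^(k + 1).
bernoulli : ∀ b k → suc b ^ k * suc b ≤ b ^ k * suc b + k * suc b ^ k
bernoulli b zero    = m≤m+n _ _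
bernoulli b (suc k) = begin
  suc b * suc b ^ k * suc b                         ≡⟨ l₁ b (suc b ^ k) ⟩
  suc b ^ k * suc b + b * (suc b ^ k * suc b)       ≤⟨ +-monoʳ-≤ (suc b ^ k * suc b) (*-monoʳ-≤ b (bernoulli b k)) ⟩
  suc b ^ k * suc b + b * (b ^ k * suc b + k * suc b ^ k) ≤⟨ m≤m+n _ (k * suc b ^ k) ⟩
  suc b ^ k * suc b + b * (b ^ k * suc b + k * suc b ^ k) + k * suc b ^ k ≡⟨ l₂ b k (suc b ^ k) (b ^ k) ⟩
  b * b ^ k * suc b + suc k * (suc b * suc b ^ k)   ∎
  where
  open ≤-Reasoning
  l₁ : ∀ b x → suc b * x * suc b ≡ x * suc b + b * (x * suc b)
  l₁ = solve-∀
  l₂ : ∀ b k x y → x * suc b + b * (y * suc b + k * x) + k * x ≡ b * y * suc b + suc k * (suc b * x)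
  l₂ = solve-∀

floorLog : ∀ n → 1 ≤ n → ∃ λ k → 2 ^ k ≤ n × n < 2 ^ suc k
floorLog (suc zero)    _ = 0 , ≤-refl , ≤-refl
floorLog (suc (suc n)) _ with floorLog (suc n) (s≤s z≤n)
... | k , lo , hi with suc (suc n) <? 2 ^ suc k
...   | yes hi′ = k , m≤n⇒m≤1+n lo , hi′
...   | no ¬hi′ = suc k , ≮⇒≥ ¬hi′ , ≤-<-trans hi (^-monoʳ-< 2 ≤-refl {suc k} ≤-refl)

-- Weights of strings with few hits

open Kraft

weight-positive : ∀ σ T → 1 ≤ weight 1 σ T
weight-positive σ zero    = ≤-refl
weight-positive σ (suc T) with σ T
... | hit    = *-mono-≤ {1} {1} ≤-refl (weight-positive σ T)
... | silent = *-mono-≤ {1} {1} ≤-refl (weight-positive σ T)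
... | other  = *-mono-≤ {1} {2} (s≤s z≤n) (weight-positive σ T)

-- For `β` = 1 no factor is below 1, so that `kraft` applies as soon as there are more than 2^T
-- entries.
length≤total : ∀ {A : Set} (σ : A → ℕ → Symbol) xs T → List.length xs ≤ total 1 σ xs T
length≤total σ []       T = z≤n
length≤total σ (x ∷ xs) T = +-mono-≤ (weight-positive (σ x) T) (length≤total σ xs T)

isHit : Symbol → ℕ
isHit hit    = 1
isHit silent = 0
isHit other  = 0

hitCount : (ℕ → Symbol) → ℕ → ℕ
hitCount σ zero    = 0
hitCount σ (suc t) = isHit (σ t) + hitCount σ t

-- Every slot without a hit contributes a factor of at least `β` to the weight; the power of `β` on
-- the right makes up for the slots with a hit.
weight-lower : ∀ β σ t → β ^ t ≤ weight β σ t * β ^ hitCount σ t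
weight-lower β σ zero    = ≤-refl
weight-lower β σ (suc t) with σ t
... | hit    = ≤-trans (*-monoʳ-≤ β (weight-lower β σ t)) (≤-reflexive (lemma β (weight β σ t) (β ^ hitCount σ t)))
  where lemma : ∀ β w h → β * (w * h) ≡ 1 * w * (β * h)
        lemma = solve-∀
... | silent = ≤-trans (*-monoʳ-≤ β (weight-lower β σ t)) (≤-reflexive (sym (*-assoc β (weight β σ t) _)))
... | other  = ≤-trans (*-mono-≤ (n≤1+n β) (weight-lower β σ t)) (≤-reflexive (sym (*-assoc (suc β) (weight β σ t) _)))

isHit-≤1 : ∀ s → isHit s ≤ 1
isHit-≤1 hit    = ≤-refl
isHit-≤1 silent = z≤n
isHit-≤1 other  = z≤n

isHit-positive : ∀ s → 0 < isHit s → s ≡ hit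
isHit-positive hit _ = refl

-- Double counting: each slot is a hit for at most one message.
∑<-hitCount : ∀ c (σ : ℕ → ℕ → Symbol) → (∀ t i j → σ i t ≡ hit → σ j t ≡ hit → i ≡ j) →
  ∀ T → ∑< c (λ i → hitCount (σ i) T) ≤ T
∑<-hitCount c σ uniq zero    = ≤-reflexive (∑<-zero c λ _ _ → refl)
∑<-hitCount c σ uniq (suc T) = ≤-trans (≤-reflexive (∑<-+ c (λ i → isHit (σ i T)) _))
  (+-mono-≤ (∑<-at-most-one c _ (λ i → isHit-≤1 (σ i T))
               (λ i j p q → uniq T i j (isHit-positive _ p) (isHit-positive _ q)))
            (∑<-hitCount c σ uniq T))

-- With 1 + β = 2c, Bernoulli's inequality gives (1 - 1 / 2c)^c ≥ 1/2.
bernoulli-half : ∀ β c → suc β ≡ 2 * c → suc β ^ c ≤ 2 * β ^ c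
bernoulli-half β c eq = *-cancelʳ-≤ _ _ (suc β) (+-cancelʳ-≤ (suc β ^ c * suc β) _ _ (begin
  suc β ^ c * suc β + suc β ^ c * suc β              ≡⟨ l₁ (suc β ^ c * suc β) ⟩
  2 * (suc β ^ c * suc β)                            ≤⟨ *-monoʳ-≤ 2 (bernoulli β c) ⟩
  2 * (β ^ c * suc β + c * suc β ^ c)                ≡⟨ l₂ (β ^ c) (suc β) c (suc β ^ c) ⟩
  2 * β ^ c * suc β + suc β ^ c * (2 * c)            ≡⟨ cong (λ x → 2 * β ^ c * suc β + suc β ^ c * x) (sym eq) ⟩
  2 * β ^ c * suc β + suc β ^ c * suc β              ∎))
  where
  open ≤-Reasoning
  l₁ : ∀ x → x + x ≡ 2 * x
  l₁ = solve-∀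
  l₂ : ∀ x y c z → 2 * (x * y + c * z) ≡ 2 * x * y + z * (2 * c)
  l₂ = solve-∀

^-distribʳ-* : ∀ k m n → (m * n) ^ k ≡ m ^ k * n ^ k
^-distribʳ-* zero    m n = refl
^-distribʳ-* (suc k) m n = trans (cong (m * n *_) (^-distribʳ-* k m n)) (lemma m n (m ^ k) (n ^ k))
  where lemma : ∀ m n a b → m * n * (a * b) ≡ m * a * (n * b)
        lemma = solve-∀

bernoulli-half^ : ∀ β c κ → suc β ≡ 2 * c → suc β ^ (c * κ) ≤ 2 ^ κ * β ^ (c * κ)
bernoulli-half^ β c κ eq = begin
  suc β ^ (c * κ)      ≡⟨ sym (^-*-assoc (suc β) c κ) ⟩
  (suc β ^ c) ^ κ      ≤⟨ ^-monoˡ-≤ κ (bernoulli-half β c eq) ⟩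
  (2 * β ^ c) ^ κ      ≡⟨ ^-distribʳ-* κ 2 (β ^ c) ⟩
  2 ^ κ * (β ^ c) ^ κ  ≡⟨ cong (2 ^ κ *_) (^-*-assoc β c κ) ⟩
  2 ^ κ * β ^ (c * κ)  ∎
  where open ≤-Reasoning

module _ {A : Set} (σ : ℕ → A → ℕ → Symbol) (unique-hit : ∀ x t i j → σ i x t ≡ hit → σ j x t ≡ hit → i ≡ j)
  (β c κ : ℕ) (1+β≡2c : suc β ≡ 2 * c) (c>0 : 0 < c) where

  private
    T : ℕ
    T = c * κ

    -- With 1 + `β` = 2 c this is 2^κ (1 + `β`)^κ: the first factor is lost to `bernoulli-half^`,
    -- the second to at most `κ` hits.
    M : ℕ
    M = (2 * (2 * c)) ^ κ

  -- The c messages share at most c κ hits, so on average each has at most `κ`.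
  rarely-hit : ∀ x → ∃ λ i → i < c × hitCount (σ i x) T ≤ κ
  rarely-hit x = ∑<-pigeonhole-≤ c _ κ (≤-<-trans (∑<-hitCount c (λ i → σ i x) (unique-hit x) T)
    (*-monoʳ-< c {{>-nonZero c>0}} ≤-refl))

  -- The message that `x` rarely hits already contributes enough. It depends on `x`, so the sum over
  -- all messages is taken before the candidates are added up.
  weights-lower : ∀ x → suc β ^ T ≤ ∑< c (λ i → weight β (σ i x) T) * M
  weights-lower x with rarely-hit x
  ... | i , i<c , h≤κ = begin
    suc β ^ T                        ≤⟨ bernoulli-half^ β c κ 1+β≡2c ⟩
    2 ^ κ * β ^ T                    ≤⟨ *-monoʳ-≤ (2 ^ κ) (weight-lower β (σ i x) T) ⟩
    2 ^ κ * (w * β ^ h)              ≤⟨ *-monoʳ-≤ (2 ^ κ) (*-monoʳ-≤ w (≤-trans (^-monoˡ-≤ h (n≤1+n β)) (^-monoʳ-≤ (suc β) h≤κ))) ⟩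
    2 ^ κ * (w * suc β ^ κ)          ≡⟨ lemma (2 ^ κ) w (suc β ^ κ) ⟩
    w * (2 ^ κ * suc β ^ κ)          ≡⟨ cong (w *_) (sym (^-distribʳ-* κ 2 (suc β))) ⟩
    w * (2 * suc β) ^ κ              ≡⟨ cong (λ b → w * (2 * b) ^ κ) 1+β≡2c ⟩
    w * M                            ≤⟨ *-monoˡ-≤ M (∑<-≥ c (λ i → weight β (σ i x) T) i i<c) ⟩
    ∑< c (λ i → weight β (σ i x) T) * M ∎
    where
    open ≤-Reasoning
    w h : ℕ
    w = weight β (σ i x) T
    h = hitCount (σ i x) T
    lemma : ∀ a w b → a * (w * b) ≡ w * (a * b)
    lemma = solve-∀

  totals-lower : ∀ xs → List.length xs * suc β ^ T ≤ ∑< c (λ i → total β (σ i) xs T) * M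
  totals-lower []       = z≤n
  totals-lower (x ∷ xs) = ≤-trans (+-mono-≤ (weights-lower x) (totals-lower xs))
    (≤-reflexive (trans (sym (*-distribʳ-+ M (∑< c (λ i → weight β (σ i x) T)) _))
                        (cong (_* M) (sym (∑<-+ c (λ i → weight β (σ i x) T) _)))))

  -- By `totals-lower`, the weights of more than c `M` candidates for all c messages add up to more
  -- than c (1 + `β`)^T, so Kraft's inequality is violated for one message.
  compatible-for-some : ∀ xs → Unique xs → c * M < List.length xs →
    ∃ λ i → i < c × CompatiblePair (σ i) xs T
  compatible-for-some xs xs! big with ∑<-pigeonhole c (λ i → total β (σ i) xs T) (suc β ^ T)
    (*-cancelʳ-< M _ _ (<-≤-trans (subst (_< List.length xs * suc β ^ T) (lemma c M (suc β ^ T))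
        (*-monoˡ-< (suc β ^ T) {{m^n≢0 (suc β) T}} big)) (totals-lower xs)))
    where lemma : ∀ c M b → c * M * b ≡ c * b * M
          lemma = solve-∀
  ... | i , i<c , big-total = i , i<c , kraft β (σ i) T xs xs! big-total

-- Runs of a protocol

mapMaybe-filter-cong : ∀ {A B : Set} {P Q : A → Set} (P? : Decidable₁ P) (Q? : Decidable₁ Q) {f g : A → Maybe B} →
  (∀ x → P x ⇔ Q x) → (∀ x → P x → f x ≡ g x) →
  ∀ xs → mapMaybe f (filter P? xs) ≡ mapMaybe g (filter Q? xs)
mapMaybe-filter-cong P? Q? P⇔Q f≡g [] = refl
mapMaybe-filter-cong P? Q? {g = g} P⇔Q f≡g (x ∷ xs) with P? x | Q? x
... | yes p | yes q rewrite f≡g x p with g x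
...   | nothing = mapMaybe-filter-cong P? Q? P⇔Q f≡g xs
...   | just y  = cong (y ∷_) (mapMaybe-filter-cong P? Q? P⇔Q f≡g xs)
mapMaybe-filter-cong P? Q? P⇔Q f≡g (x ∷ xs) | no ¬p | no ¬q = mapMaybe-filter-cong P? Q? P⇔Q f≡g xs
mapMaybe-filter-cong P? Q? P⇔Q f≡g (x ∷ xs) | yes p | no ¬q = contradiction (Equivalence.to (P⇔Q x) p) ¬q
mapMaybe-filter-cong P? Q? P⇔Q f≡g (x ∷ xs) | no ¬p | yes q = contradiction (Equivalence.from (P⇔Q x) q) ¬p

module _ {A B : Set} (f : A → Maybe B) where

  mapMaybe-empty : ∀ {xs x} → mapMaybe f xs ≡ [] → x ∈ xs → f x ≡ nothing
  mapMaybe-empty {y ∷ ys} eq x∈ with f y in fy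
  mapMaybe-empty {y ∷ ys} eq (here refl) | nothing = fy
  mapMaybe-empty {y ∷ ys} eq (there x∈)  | nothing = mapMaybe-empty eq x∈

  mapMaybe-singleton : ∀ {xs m} → mapMaybe f xs ≡ m ∷ [] →
    ∃ λ x → x ∈ xs × f x ≡ just m × (∀ {y} → y ∈ xs → y ≢ x → f y ≡ nothing)
  mapMaybe-singleton {x ∷ xs} eq with f x in fx
  mapMaybe-singleton {x ∷ xs} eq | just m with refl ← ∷-injectiveˡ eq =
    x , here refl , fx , λ where
      (here refl) y≢x → contradiction refl y≢x
      (there y∈)  _   → mapMaybe-empty (∷-injectiveʳ eq) y∈
  mapMaybe-singleton {x ∷ xs} eq | nothing =
    let z , z∈ , fz , others = mapMaybe-singleton eq
    in z , there z∈ , fz , λ where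
         (here refl) _   → fx
         (there y∈)  y≢z → others y∈ y≢z

sole-just : ∀ {A : Set} (xs : List A) {m} → sole xs ≡ just m → xs ≡ m ∷ []
sole-just (x ∷ []) refl = refl

transmitted-just : ∀ {M} (a : Action M) {m} → transmitted a ≡ just m → a ≡ transmit m
transmitted-just (transmit m) refl = refl

transmitted-nothing : ∀ {M} (a : Action M) → transmitted a ≡ nothing → a ≡ receive
transmitted-nothing receive refl = refl

module _ {n : ℕ} (G G′ : Digraph n) where
  private
    module G  = Digraph G
    module G′ = Digraph G′

  hears-cong : ∀ {M} {acts acts′ : Fin n → Action M} {v} → acts v ≡ acts′ v →
    (∀ u → (u G.⟶ v) ⇔ (u G′.⟶ v)) → (∀ u → u G.⟶ v → acts u ≡ acts′ u) →
    hears G acts v ≡ hears G′ acts′ v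
  hears-cong {acts = acts} {acts′} {v} acts≡ edges⇔ nbrs≡ with acts v | acts′ v | acts≡
  ... | transmit _ | _ | refl = refl
  ... | receive    | _ | refl = cong sole
    (mapMaybe-filter-cong (G._⟶? v) (G′._⟶? v) edges⇔ (λ u → cong transmitted ∘ nbrs≡ u) (allFin n))

module _ {n : ℕ} (G : Digraph n) where
  open Digraph G

  hears-just : ∀ {M} (acts : Fin n → Action M) {v m} → hears G acts v ≡ just m →
    ∃ λ x → x ⟶ v × acts x ≡ transmit m × (∀ {y} → y ⟶ v → y ≢ x → acts y ≡ receive)
  hears-just acts {v} eq with acts v
  ... | receive =
    let x , x∈ , fx , others = mapMaybe-singleton _ (sole-just _ eq)
    in x , proj₂ (∈-filter⁻ (_⟶? v) {xs = allFin n} x∈) , transmitted-just (acts x) fx ,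
       λ {y} y⟶v y≢x → transmitted-nothing (acts y) (others (∈-filter⁺ (_⟶? v) (∈-allFin y) y⟶v) y≢x)

module _ {M : Set} {H : M → Set} (H? : Decidable₁ H) where

  -- `H` selects the messages whose passage is to be blocked: those that contain a given broadcast
  -- message, or all of them.
  classify : Action M → Symbol
  classify receive      = silent
  classify (transmit m) with H? m
  ... | yes _ = hit
  ... | no  _ = other

  classify-hit : ∀ {m} → H m → classify (transmit m) ≡ hit
  classify-hit {m} Hm with H? m
  ... | yes _  = refl
  ... | no ¬Hm = contradiction Hm ¬Hm

  classify-hit⁻ : ∀ x → classify x ≡ hit → ∃ λ m → x ≡ transmit m × H m
  classify-hit⁻ (transmit m) eq with H? m
  ... | yes Hm = m , refl , Hm

  -- To be heard, a message needs one of `a` and `b` to transmit it and the other to listen; if it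
  -- satisfies `H`, this is the incompatible pair of a hit and silence.
  compatible⇒unheard : ∀ {n} (G : Digraph n) (acts : Fin n → Action M) {v a b m} → a ≢ b →
    (∀ u → Digraph._⟶_ G u v ⇔ (u ≡ a ⊎ u ≡ b)) → Compatible (classify (acts a)) (classify (acts b)) →
    hears G acts v ≡ just m → ¬ H m
  compatible⇒unheard G acts {v} {a} {b} a≢b nbrs compat heard Hm with hears-just G acts heard
  ... | x , x⟶v , x-transmits , others with Equivalence.to (nbrs x) x⟶v
  ...   | inj₁ refl rewrite x-transmits | others (Equivalence.from (nbrs b) (inj₂ refl)) (≢-sym a≢b) | classify-hit Hm
    with compat
  ...     | ()
  compatible⇒unheard G acts {v} {a} {b} a≢b nbrs compat heard Hm | x , x⟶v , x-transmits , others
        | inj₂ refl rewrite x-transmits | others (Equivalence.from (nbrs a) (inj₁ refl)) a≢b | classify-hit Hm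
    with compat
  ...     | ()

module _ (P : Protocol) where
  open Protocol P

  module _ {n r : ℕ} (G : Digraph n) (B : Broadcasts n r) where
    open Broadcasts B

    action : ℕ → Fin n → Action Message
    action t u = act (label P G B u) (own u) t (history P G B t u)

    received? : ∀ t v z → Dec (ReceivedWithin P G B t v z)
    received? t v z = VecAny.any? (MaybeAny.dec λ m → Maybe.≡-dec _≟_ (recover m) (just z)) (history P G B t v)

    received-mono : ∀ {t t′ v z} → t ≤′ t′ → ReceivedWithin P G B t v z → ReceivedWithin P G B t′ v z
    received-mono ≤′-refl        rec = rec
    received-mono (≤′-step t≤t′) rec = VecAny.there (received-mono t≤t′ rec)

    not-yet : ∀ {t T v i} → HasToReceive G B v i → ¬ ReceivedWithin P G B t v (message i) →
      CompletedWithin P G B T → t < T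
    not-yet {t} {T} {v} {i} must ¬rec done = ≰⇒> λ T≤t → ¬rec (received-mono (≤⇒≤′ T≤t) (done v i must))

    unheard⇒¬received : ∀ {v z} T → (∀ t → t < T → ∀ m → hears G (action t) v ≡ just m → recover m ≢ just z) →
      ¬ ReceivedWithin P G B T v z
    unheard⇒¬received {v} (suc T) unheard (VecAny.here px)   with hears G (action T) v in eq | px
    ... | just m | MaybeAny.just rec = unheard T ≤-refl m eq rec
    unheard⇒¬received {v} (suc T) unheard (VecAny.there pxs) =
      unheard⇒¬received T (λ t t<T → unheard t (m<n⇒m<1+n t<T)) pxs

  module _ {M : Set} (rec : M → Maybe BroadcastMessage) where

    -- A transmission contains at most one broadcast message, so the slot of reception determines
    -- the ID.
    index-injective : ∀ {T z z′} {h : Vec (Maybe M) T}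
      (p : VecAny.Any (MaybeAny.Any (λ m → rec m ≡ just z)) h) (p′ : VecAny.Any (MaybeAny.Any (λ m → rec m ≡ just z′)) h) →
      VecAny.index p ≡ VecAny.index p′ → z ≡ z′
    index-injective (VecAny.here (MaybeAny.just p)) (VecAny.here (MaybeAny.just p′)) _ = Maybe.just-injective (trans (sym p) p′)
    index-injective (VecAny.there p) (VecAny.there p′) eq = index-injective p p′ (Fin.suc-injective eq)

  module _ {n r r′ : ℕ} (G G′ : Digraph n) (B : Broadcasts n r) (B′ : Broadcasts n r′) where
    private
      module G  = Digraph G
      module G′ = Digraph G′
      module B  = Broadcasts B
      module B′ = Broadcasts B′

    -- K t v marks the pairs for which the two runs have to agree at v before slot t.
    history-cong : (K : ℕ → Fin n → Set) → (∀ {t v} → K t v → B.own v ≡ B′.own v) →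
      (∀ {t v} → K (suc t) v → K t v ×
        (hears G (action G B t) v ≡ hears G′ (action G′ B′ t) v
         ⊎ (∀ u → (u G.⟶ v) ⇔ (u G′.⟶ v)) × (∀ u → u G.⟶ v → K t u))) →
      ∀ t {v} → K t v → history P G B t v ≡ history P G′ B′ t v
    action-cong : (K : ℕ → Fin n → Set) → (∀ {t v} → K t v → B.own v ≡ B′.own v) →
      (∀ {t v} → K (suc t) v → K t v ×
        (hears G (action G B t) v ≡ hears G′ (action G′ B′ t) v
         ⊎ (∀ u → (u G.⟶ v) ⇔ (u G′.⟶ v)) × (∀ u → u G.⟶ v → K t u))) →
      ∀ t {v} → K t v → action G B t v ≡ action G′ B′ t v
    action-cong K own≡ step t {v} k = cong₂ (λ o → act (suc (toℕ v)) o t) (own≡ k) (history-cong K own≡ step t k)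
    history-cong K own≡ step zero    k = refl
    history-cong K own≡ step (suc t) k with step k
    -- The in-neighbours may act differently here, for instance when nothing is heard in either run.
    ... | k′ , inj₁ same = cong₂ Vec._∷_ same (history-cong K own≡ step t k′)
    ... | k′ , inj₂ (edges⇔ , nbrs) = cong₂ Vec._∷_
      (hears-cong G G′ (action-cong K own≡ step t k′) edges⇔ (λ u e → action-cong K own≡ step t (nbrs u e)))
      (history-cong K own≡ step t k′)

-- Layered graphs

Levelling : ℕ → Set
Levelling n = Fin n → ℕ

-- Nodes above level D are isolated.
layered : ∀ {n} → ℕ → Levelling n → Digraph n
layered D lev = record
  { _⟶_      = λ u v → suc (lev u) ≡ lev v × lev v ≤ D
  ; _⟶?_     = λ u v → (suc (lev u) ≟ lev v) ×-dec (lev v ≤? D)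
  ; loopless = λ v (eq , _) → 1+n≢n eq
  }

module _ {n : ℕ} (j : ℕ) (a b : Fin n) (lev : Levelling n) where

  -- Makes `a` and `b` a layer of their own: the other nodes of their level move up by one, to be
  -- observed there at the next pick.
  refine : Levelling n
  refine x with lev x ≟ suc j | x Fin.≟ a | x Fin.≟ b
  ... | yes _ | no _  | no _  = suc (suc j)
  ... | no _  | _     | _     = lev x
  ... | yes _ | yes _ | _     = lev x
  ... | yes _ | no _  | yes _ = lev x

  refine-cases : ∀ x → (lev x ≡ suc j × x ≢ a × x ≢ b × refine x ≡ suc (suc j))
                     ⊎ ((lev x ≢ suc j ⊎ x ≡ a ⊎ x ≡ b) × refine x ≡ lev x)
  refine-cases x with lev x ≟ suc j | x Fin.≟ a | x Fin.≟ b
  ... | yes p | no q  | no r  = inj₁ (p , q , r , refl)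
  ... | no p  | _     | _     = inj₂ (inj₁ p , refl)
  ... | yes _ | yes q | _     = inj₂ (inj₂ (inj₁ q) , refl)
  ... | yes _ | no _  | yes r = inj₂ (inj₂ (inj₂ r) , refl)

  refine-raised : ∀ {x} → lev x ≡ suc j → x ≢ a → x ≢ b → refine x ≡ suc (suc j)
  refine-raised {x} p q r with refine-cases x
  ... | inj₁ (_ , _ , _ , eq)       = eq
  ... | inj₂ (inj₁ ¬p , _)          = contradiction p ¬p
  ... | inj₂ (inj₂ (inj₁ x≡a) , _)  = contradiction x≡a q
  ... | inj₂ (inj₂ (inj₂ x≡b) , _)  = contradiction x≡b r

  refine-a : refine a ≡ lev a
  refine-a with refine-cases a
  ... | inj₁ (_ , a≢a , _) = contradiction refl a≢a
  ... | inj₂ (_ , eq)      = eq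

  refine-b : refine b ≡ lev b
  refine-b with refine-cases b
  ... | inj₁ (_ , _ , b≢b , _) = contradiction refl b≢b
  ... | inj₂ (_ , eq)          = eq

  -- A node that moves goes from level j + 1 to level j + 2 and so is above level `j` both before
  -- and after.
  refine-agrees : ∀ x → lev x ≤ j ⊎ refine x ≤ j → lev x ≡ refine x
  refine-agrees x low with refine-cases x
  ... | inj₂ (_ , eq) = sym eq
  refine-agrees x (inj₁ low) | inj₁ (p , _) = contradiction (subst (_≤ j) p low) (<⇒≱ ≤-refl)
  refine-agrees x (inj₂ low) | inj₁ (_ , _ , _ , eq) = contradiction (subst (_≤ j) eq low) (<⇒≱ (n≤1+n _))

  refine-≡ : ∀ x {i} → i ≤ j → refine x ≡ i ⇔ lev x ≡ i
  refine-≡ x i≤j = mk⇔ (λ eq → trans (refine-agrees x (inj₂ (subst (_≤ j) (sym eq) i≤j))) eq)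
                       (λ eq → trans (sym (refine-agrees x (inj₁ (subst (_≤ j) (sym eq) i≤j)))) eq)

  refine-members : lev a ≡ suc j → lev b ≡ suc j → ∀ x → refine x ≡ suc j ⇔ (x ≡ a ⊎ x ≡ b)
  refine-members la lb x = mk⇔ to λ where
      (inj₁ refl) → trans refine-a la
      (inj₂ refl) → trans refine-b lb
    where
    to : refine x ≡ suc j → x ≡ a ⊎ x ≡ b
    to eq with refine-cases x
    ... | inj₁ (_ , _ , _ , eq′)   = contradiction (trans (sym eq′) eq) 1+n≢n
    ... | inj₂ (inj₂ x∈ab , _)     = x∈ab
    ... | inj₂ (inj₁ lev≢ , eq′)   = contradiction (trans (sym eq′) eq) lev≢

-- `Good j lev a b` is what an adversary secures when it picks `a` and `b` from level j + 1 of the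
-- levelling `lev`.
module Towers {n : ℕ} (s d : Fin n) (s≢d : s ≢ d) (D : ℕ)
  (Good : ℕ → Levelling n → Fin n → Fin n → Set) where

  -- The layer was picked when the levels were `before`; above level i they may have changed since.
  record Layer (lev : Levelling n) (i : ℕ) : Set where
    field
      left right : Fin n
      distinct   : left ≢ right
      members    : ∀ x → lev x ≡ suc i ⇔ (x ≡ left ⊎ x ≡ right)
      before     : Levelling n
      good       : Good i before left right
      agrees     : ∀ x → before x ≤ i ⊎ lev x ≤ i → before x ≡ lev x
      left-before  : before left ≡ suc i
      right-before : before right ≡ suc i

  record Tower (j : ℕ) (lev : Levelling n) : Set where
    field
      root    : ∀ x → lev x ≡ 0 ⇔ x ≡ s
      parked  : lev d ≡ suc D
      bounded : ∀ x → lev x ≤ suc D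
      layer   : ∀ i → i < j → Layer lev i

  -- Nodes not yet picked stay on level suc j, so that a pick can observe each of them in that place.
  record Stage (j : ℕ) : Set where
    field
      lev   : Levelling n
      tower : Tower j lev
      pool  : List (Fin n)
      pool! : Unique pool
      pool-lev  : ∀ {x} → x ∈ pool → lev x ≡ suc j
      -- Used up are `s`, `d` and two nodes for each of the `j` layers.
      pool-size : n ≤ 2 * suc j + List.length pool

  Pick : Set
  Pick = ∀ j lev pool → j < D → Unique pool → n ≤ 2 * suc j + List.length pool →
    ∃₂ λ a b → a ∈ pool × b ∈ pool × a ≢ b × Good j lev a b

  start : 0 < D → Stage 0
  start D>0 = record
    { lev   = lev₀
    ; tower = record
      { root    = λ x → mk⇔ (root x) (λ { refl → lev₀-s })
      ; parked  = lev₀-d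
      ; bounded = bounded
      ; layer   = λ _ ()
      }
    ; pool  = remove Fin._≟_ d (remove Fin._≟_ s (allFin n))
    ; pool! = Unique.filter⁺ _ (Unique.filter⁺ _ (Unique.allFin⁺ n))
    ; pool-lev  = λ x∈ →
        let x∈′ , x≢d = ∈-filter⁻ _ {xs = remove Fin._≟_ s (allFin n)} x∈
            _   , x≢s = ∈-filter⁻ (λ y → ¬? (y Fin.≟ s)) {xs = allFin n} x∈′
        in lev₀-1 x≢s x≢d
    ; pool-size = ≤-trans (≤-reflexive (sym (length-tabulate {n = n} id)))
        (≤-trans (length-remove Fin._≟_ s (Unique.allFin⁺ n)) (s≤s (length-remove Fin._≟_ d (Unique.filter⁺ _ (Unique.allFin⁺ n)))))
    }
    where
    lev₀ : Levelling n
    lev₀ x with x Fin.≟ s | x Fin.≟ d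
    ... | yes _ | _     = 0
    ... | no  _ | yes _ = suc D
    ... | no  _ | no _  = 1

    lev₀-s : lev₀ s ≡ 0
    lev₀-s with s Fin.≟ s | s Fin.≟ d
    ... | yes _ | _  = refl
    ... | no s≢s | _ = contradiction refl s≢s

    lev₀-d : lev₀ d ≡ suc D
    lev₀-d with d Fin.≟ s | d Fin.≟ d
    ... | yes d≡s | _ = contradiction (sym d≡s) s≢d
    ... | no _ | yes _  = refl
    ... | no _ | no d≢d = contradiction refl d≢d

    lev₀-1 : ∀ {x} → x ≢ s → x ≢ d → lev₀ x ≡ 1
    lev₀-1 {x} x≢s x≢d with x Fin.≟ s | x Fin.≟ d
    ... | yes x≡s | _ = contradiction x≡s x≢s
    ... | no _ | yes x≡d = contradiction x≡d x≢d
    ... | no _ | no _ = refl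

    root : ∀ x → lev₀ x ≡ 0 → x ≡ s
    root x eq with x Fin.≟ s | x Fin.≟ d
    ... | yes x≡s | _     = x≡s
    ... | no _    | yes _ = contradiction eq λ ()
    ... | no _    | no _  = contradiction eq λ ()

    bounded : ∀ x → lev₀ x ≤ suc D
    bounded x with x Fin.≟ s | x Fin.≟ d
    ... | yes _ | _     = z≤n
    ... | no  _ | yes _ = ≤-refl
    ... | no  _ | no _  = s≤s z≤n

  grow : Pick → ∀ {j} → j < D → Stage j → Stage (suc j)
  grow pick {j} j<D st with pick j (Stage.lev st) (Stage.pool st) j<D (Stage.pool! st) (Stage.pool-size st)
  ... | a , b , a∈ , b∈ , a≢b , good = record
    { lev   = lev′
    ; tower = record
      { root    = λ x → mk⇔ (Equivalence.to (root x) ∘ Equivalence.to (refine-≡ j a b lev x z≤n))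
                            (Equivalence.from (refine-≡ j a b lev x z≤n) ∘ Equivalence.from (root x))
      ; parked  = parked′
      ; bounded = bounded′
      ; layer   = layer′
      }
    ; pool  = remove Fin._≟_ b (remove Fin._≟_ a pool)
    ; pool! = Unique.filter⁺ _ (Unique.filter⁺ _ pool!)
    ; pool-lev  = λ x∈ →
        let x∈′ , x≢b = ∈-filter⁻ _ {xs = remove Fin._≟_ a pool} x∈
            x∈″ , x≢a = ∈-filter⁻ (λ y → ¬? (y Fin.≟ a)) {xs = pool} x∈′
        in refine-raised j a b lev (pool-lev x∈″) x≢a x≢b
    ; pool-size = ≤-trans pool-size (≤-trans (+-monoʳ-≤ (2 * suc j) (≤-trans (length-remove Fin._≟_ a pool!)
        (s≤s (length-remove Fin._≟_ b (Unique.filter⁺ _ pool!))))) (≤-reflexive (lemma j _)))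
    }
    where
    open Stage st
    open Tower tower
    lev′ : Levelling n
    lev′ = refine j a b lev

    lemma : ∀ j l → 2 * suc j + suc (suc l) ≡ 2 * suc (suc j) + l
    lemma = solve-∀

    parked′ : lev′ d ≡ suc D
    parked′ with refine-cases j a b lev d
    ... | inj₂ (_ , eq) = trans eq parked
    ... | inj₁ (eq , _) = contradiction (suc-injective (trans (sym eq) parked)) (<⇒≢ j<D)

    bounded′ : ∀ x → lev′ x ≤ suc D
    bounded′ x with refine-cases j a b lev x
    ... | inj₂ (_ , eq) = ≤-trans (≤-reflexive eq) (bounded x)
    ... | inj₁ (_ , _ , _ , eq) = ≤-trans (≤-reflexive eq) (s≤s j<D)

    layer′ : ∀ i → i < suc j → Layer lev′ i
    layer′ i i<sj with m<1+n⇒m<n∨m≡n i<sj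
    ... | inj₂ refl = record
      { left = a ; right = b ; distinct = a≢b
      ; members = refine-members j a b lev (pool-lev a∈) (pool-lev b∈)
      ; before = lev ; good = good ; agrees = refine-agrees j a b lev
      ; left-before = pool-lev a∈ ; right-before = pool-lev b∈
      }
    ... | inj₁ i<j = record
      { left = left ; right = right ; distinct = distinct
      ; members = λ x → mk⇔ (Equivalence.to (members x) ∘ Equivalence.to (refine-≡ j a b lev x i<j))
                            (Equivalence.from (refine-≡ j a b lev x i<j) ∘ Equivalence.from (members x))
      ; before = before ; good = good′ 
      ; agrees = λ where
          x (inj₁ low) → let eq = agrees x (inj₁ low) in
            trans eq (refine-agrees j a b lev x (inj₁ (≤-trans (subst (_≤ i) eq low) (<⇒≤ i<j))))
          x (inj₂ low) → let eq = refine-agrees j a b lev x (inj₂ (≤-trans low (<⇒≤ i<j))) in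
            trans (agrees x (inj₂ (subst (_≤ i) (sym eq) low))) eq
      ; left-before = left-before ; right-before = right-before
      }
      where open Layer (layer i i<j) renaming (good to good′)

  build : Pick → 0 < D → ∃ (Tower D)
  build pick D>0 = let st = stage D ≤-refl in Stage.lev st , Stage.tower st
    where
    stage : ∀ j → j ≤ D → Stage j
    stage zero    _   = start D>0
    stage (suc j) j<D = grow pick j<D (stage j (<⇒≤ j<D))

-- The operations, and the parameters of a finished graph

module _ {n : ℕ} (s d : Fin n) (c r z : ℕ) where

  -- The shift z lets the adversary choose IDs that the protocol does not guess.
  -- The operations beyond the first c start at d, which reaches no other node.
  broadcasts : Broadcasts n r
  broadcasts = record
    { message  = λ i → z + toℕ i
    ; source   = source
    ; distinct = λ eq → Fin.toℕ-injective (+-cancelˡ-≡ z _ _ eq)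
    }
    where
    source : Fin r → Fin n
    source i with toℕ i <? c
    ... | yes _ = s
    ... | no  _ = d

  open Broadcasts broadcasts

  source-low : ∀ i → toℕ i < c → source i ≡ s
  source-low i i<c with toℕ i <? c
  ... | yes _   = refl
  ... | no  i≮c = contradiction i<c i≮c

  -- This keeps `z` secret: all nodes but `s` and `d` start in the same state whatever `z` is.
  own-empty : ∀ v → v ≢ s → v ≢ d → own v ≡ []
  own-empty v v≢s v≢d = cong (List.map message) (filter-none (λ i → source i Fin.≟ v) (All.universal no-source (allFin r)))
    where
    no-source : ∀ i → source i ≢ v
    no-source i eq with toℕ i <? c
    ... | yes i<c = v≢s (sym eq)
    ... | no  i≮c = v≢d (sym eq)

module TowerGraph {n : ℕ} (s d : Fin n) (s≢d : s ≢ d) (D : ℕ) (D≥2 : 2 ≤ D)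
  {Good : ℕ → Levelling n → Fin n → Fin n → Set}
  (lev : Levelling n) (tower : Towers.Tower s d s≢d D Good D lev) where

  open Towers s d s≢d D Good

  open Tower tower

  G : Digraph n
  G = layered D lev

  open Digraph G

  -- Mind the shift: `layer i` occupies level i + 1 and therefore feeds level i + 2.
  in-neighbours : ∀ {v i} → lev v ≡ suc (suc i) → (si<D : suc i < D) →
    ∀ u → (u ⟶ v) ⇔ (u ≡ Layer.left (layer i (<⇒≤ si<D)) ⊎ u ≡ Layer.right (layer i (<⇒≤ si<D)))
  in-neighbours {v} {i} lv si<D u = mk⇔
    (λ (eq , _) → Equivalence.to (members u) (suc-injective (trans eq lv)))
    (λ u∈ → trans (cong suc (Equivalence.from (members u) u∈)) (sym lv) , subst (_≤ D) (sym lv) si<D)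
    where open Layer (layer i (<⇒≤ si<D))

  occupied : ∀ j → j ≤ D → ∃ λ u → lev u ≡ j
  occupied zero    _   = s , Equivalence.from (root s) refl
  occupied (suc j) j<D = left , Equivalence.from (members left) (inj₁ refl)
    where open Layer (layer j j<D)

  level : ∀ {j} → j ≤ D → Fin n
  level {j} j≤D = proj₁ (occupied j j≤D)

  -- Every edge climbs one level; hence all walks between two given nodes are equally long, and any
  -- of them realises the distance.
  walk-length : ∀ {u v} (p : Walk G u v) → lev u + length G p ≡ lev v
  walk-length {u} ε = +-identityʳ (lev u)
  walk-length {u} ((eq , _) ◅ p) = trans (+-suc (lev u) _) (trans (cong (_+ length G p) eq) (walk-length p))

  -- The last edge of a walk ends at level `D` or below.
  walk-length≤ : ∀ {u v} (p : Walk G u v) → length G p ≤ D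
  walk-length≤ ε       = z≤n
  walk-length≤ {u} {v} (e ◅ p) = ≤-trans (m≤n+m _ (lev u)) (≤-trans (≤-reflexive (walk-length (e ◅ p))) (ends (e ◅ p) z<s))
    where
    ends : ∀ {u v} (p : Walk G u v) → 0 < length G p → lev v ≤ D
    ends (e ◅ ε)      _ = proj₂ e
    ends (e ◅ e′ ◅ p) _ = ends (e′ ◅ p) z<s

  walk-from-root : ∀ {j v} → lev v ≡ j → j ≤ D → Walk G s v
  walk-from-root {zero} {v} lv _ = subst (Walk G s) (sym (Equivalence.to (root v) lv)) ε
  walk-from-root {suc j} {v} lv j<D with occupied j (<⇒≤ j<D)
  ... | u , lu = walk-from-root lu (<⇒≤ j<D) ◅◅ (trans (cong suc lu) (sym lv) , subst (_≤ D) (sym lv) j<D) ◅ ε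

  -- An edge out of `d` would end on level D + 2, above all edges.
  no-walk-from-parked : ∀ {v} → Walk G d v → d ≡ v
  no-walk-from-parked ε = refl
  no-walk-from-parked ((eq , low) ◅ p) =
    contradiction (subst (_≤ D) (trans (sym eq) (cong suc parked)) low) (<⇒≱ (m≤n⇒m≤1+n ≤-refl))

  maxEccentricity : MaxEccentricity G D
  maxEccentricity = (s , (v , (walk , walk-D walk) , λ k (p , eq) → ≤-reflexive (trans (sym (walk-D p)) eq)) ,
                       λ { k (_ , (p , refl) , _) → walk-length≤ p }) ,
                    λ { e (u , (_ , (p , refl) , _) , _) → walk-length≤ p }
    where
    v : Fin n
    v = level {D} ≤-refl
    lv : lev v ≡ D
    lv = proj₂ (occupied D ≤-refl)
    walk : Walk G s v
    walk = walk-from-root lv ≤-refl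
    walk-D : (p : Walk G s v) → length G p ≡ D
    walk-D p = trans (cong (_+ length G p) (sym (Equivalence.from (root s) refl))) (trans (walk-length p) lv)

  maxInDegree : MaxInDegree G 2
  maxInDegree = (v , hasCardinality (left ∷ right ∷ []) ((distinct ∷ []) ∷ [] ∷ []) edges) , bound
    where
    open Layer (layer 0 (<⇒≤ D≥2))
    v : Fin n
    v = level D≥2
    edges : ∀ u → u ∈ left ∷ right ∷ [] ⇔ (u ⟶ v)
    edges u = mk⇔ (λ where
        (here eq)         → Equivalence.from nbrs (inj₁ eq)
        (there (here eq)) → Equivalence.from nbrs (inj₂ eq)
        (there (there ())))
      (λ e → case Equivalence.to nbrs e of λ where
        (inj₁ eq) → here eq
        (inj₂ eq) → there (here eq))
      where nbrs = in-neighbours (proj₂ (occupied 2 D≥2)) D≥2 u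
    bound : ∀ k → (∃ λ v → InDegree G v k) → k ≤ 2
    bound k (v , card) = bound-at (lev v) refl card
      where
      bound-at : ∀ ℓ → lev v ≡ ℓ → InDegree G v k → k ≤ 2
      bound-at zero lv card = ≤-trans (cardinality≤ [] (λ u (eq , _) → contradiction (trans eq lv) λ ()) card) z≤n
      bound-at (suc zero) lv card = ≤-trans (cardinality≤ (s ∷ [])
            (λ u (eq , _) → here (Equivalence.to (root u) (suc-injective (trans eq lv)))) card) (s≤s z≤n)
      bound-at (suc (suc i)) lv card with suc i <? D
      ... | no  i≮D = ≤-trans (cardinality≤ [] (λ u (_ , low) → contradiction (subst (_≤ D) lv low) i≮D) card) z≤n
      ... | yes i<D = cardinality≤ (L.left ∷ L.right ∷ [])
            (λ u e → case Equivalence.to (in-neighbours lv i<D u) e of λ where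
              (inj₁ eq) → here eq
              (inj₂ eq) → there (here eq)) card
        where module L = Layer (layer i (<⇒≤ i<D))

  module _ (c r z : ℕ) (c≤r : c ≤ r) where

    B : Broadcasts n r
    B = broadcasts s d c r z

    open Broadcasts B

    above-root : ∀ {v j} → lev v ≡ suc j → v ≢ s
    above-root lv refl = contradiction (trans (sym lv) (Equivalence.from (root s) refl)) λ ()

    must-receive : ∀ {v j} → lev v ≡ suc j → j < D → ∀ i → toℕ i < c → HasToReceive G B v i
    must-receive {v} lv j<D i i<c =
      (λ eq → above-root lv (trans (sym eq) src)) , subst (λ u → Walk G u v) (sym src) (walk-from-root lv j<D)
      where src = source-low s d c r z i i<c

    must-receive⁻ : ∀ {v i} → HasToReceive G B v i → toℕ i < c
    must-receive⁻ {v} {i} (src≢v , walk) with toℕ i <? c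
    ... | yes i<c = i<c
    ... | no  i≮c = contradiction (no-walk-from-parked walk) src≢v

    congestion : Congestion G B c
    congestion = (v , subst (HasCardinality _) length-low (hasCardinality low low! low⇔)) ,
                 λ k (_ , card) → subst (k ≤_) length-low (cardinality≤ low (λ i → low⁺ ∘ must-receive⁻) card)
      where
      v : Fin n
      v = level {1} (<⇒≤ D≥2)
      low : List (Fin r)
      low = List.map (λ i → inject≤ i c≤r) (allFin c)
      low! : Unique low
      low! = Unique.map⁺ (Fin.inject≤-injective c≤r c≤r _ _) (Unique.allFin⁺ c)
      length-low : List.length low ≡ c
      length-low = trans (length-map _ (allFin c)) (length-tabulate {n = c} id)
      low⁺ : ∀ {i} → toℕ i < c → i ∈ low
      low⁺ {i} i<c = subst (_∈ low) (Fin.toℕ-injective (trans (Fin.toℕ-inject≤ _ c≤r) (Fin.toℕ-fromℕ< i<c)))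
        (∈-map⁺ _ (∈-allFin (fromℕ< i<c)))
      low⁻ : ∀ {i} → i ∈ low → toℕ i < c
      low⁻ i∈ with ∈-map⁻ _ i∈
      ... | k , _ , refl = subst (_< c) (sym (Fin.toℕ-inject≤ k c≤r)) (Fin.toℕ<n k)
      low⇔ : ∀ i → i ∈ low ⇔ HasToReceive G B v i
      low⇔ i = mk⇔ (must-receive (proj₂ (occupied 1 (<⇒≤ D≥2))) (<⇒≤ D≥2) i ∘ low⁻) (low⁺ ∘ must-receive⁻)

    -- A node of level 1 has to receive c messages, and by `index-injective` it does so in c
    -- different slots.
    congestion≤time : ∀ P T → CompletedWithin P G B T → c ≤ T
    congestion≤time P T done = Fin.injective⇒≤ {f = slot} slot-injective
      where
      v : Fin n
      v = level {1} (<⇒≤ D≥2)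
      rec : ∀ (i : Fin c) → ReceivedWithin P G B T v (message (inject≤ i c≤r))
      rec i = done v (inject≤ i c≤r) (must-receive (proj₂ (occupied 1 (<⇒≤ D≥2))) (<⇒≤ D≥2) _
        (subst (_< c) (sym (Fin.toℕ-inject≤ i c≤r)) (Fin.toℕ<n i)))
      slot : Fin c → Fin T
      slot i = VecAny.index (rec i)
      slot-injective : ∀ {i j} → slot i ≡ slot j → i ≡ j
      slot-injective {i} {j} eq = Fin.inject≤-injective c≤r c≤r i j
        (distinct (index-injective P (Protocol.recover P) (rec i) (rec j) eq))

    own-layer : ∀ {v j} → lev v ≡ suc j → j < D → own v ≡ []
    own-layer {v} lv j<D = own-empty s d c r z v (above-root lv)
      λ { refl → contradiction (suc-injective (trans (sym lv) parked)) (<⇒≢ j<D) }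

-- The two adversaries

-- Information only climbs, so a node of level i + 1 is influenced by nothing above level `i` except
-- itself. Hence what was observed when a layer was picked remains true in the final graph.
action-local : ∀ P {n r} D (lev lev′ : Levelling n) (B : Broadcasts n r) {i} →
  (∀ x → lev x ≤ i ⊎ lev′ x ≤ i → lev x ≡ lev′ x) →
  ∀ {v} → lev v ≡ suc i → lev′ v ≡ suc i → ∀ t →
  action P (layered D lev) B t v ≡ action P (layered D lev′) B t v
action-local P D lev lev′ B {i} agree {v} lv lv′ t =
  action-cong P (layered D lev) (layered D lev′) B B K (λ _ → refl)
    (λ {t} k → k , inj₂ (edges t k , nbrs t k)) t {v} (trans lv (sym lv′) , ≤-reflexive lv)
  where
  K : ℕ → Fin _ → Set
  K _ v = lev v ≡ lev′ v × lev v ≤ suc i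
  edges : ∀ t {v} → K t v → ∀ u → Digraph._⟶_ (layered D lev) u v ⇔ Digraph._⟶_ (layered D lev′) u v
  edges t {v} (eq , low) u = mk⇔
    (λ (e , l) → trans (cong suc (sym (agree u (inj₁ (≤-pred (subst (_≤ suc i) (sym e) low)))))) (trans e eq) , subst (_≤ D) eq l)
    (λ (e , l) → trans (cong suc (agree u (inj₂ (≤-pred (subst (_≤ suc i) (trans eq (sym e)) low))))) (trans e (sym eq)) , subst (_≤ D) (sym eq) l)
  nbrs : ∀ t {v} → K t v → ∀ u → Digraph._⟶_ (layered D lev) u v → K t u
  nbrs t {v} (eq , low) u (e , _) =
    let lu = ≤-pred (subst (_≤ suc i) (sym e) low) in agree u (inj₁ lu) , m≤n⇒m≤1+n lu

-- At each of the `D` picks at most 2 D nodes have been used up, `s` and `d` included.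
pool-large : ∀ {n D j l X} → X + 2 * D < n → j < D → n ≤ 2 * suc j + l → X < l
pool-large {n} {D} {j} {l} {X} X+2D<n j<D n≤ = +-cancelˡ-< (2 * D) _ _ (begin-strict
  2 * D + X       ≡⟨ +-comm (2 * D) X ⟩
  X + 2 * D       <⟨ X+2D<n ⟩
  n               ≤⟨ n≤ ⟩
  2 * suc j + l   ≤⟨ +-monoˡ-≤ l (*-monoʳ-≤ 2 j<D) ⟩
  2 * D + l       ∎)
  where open ≤-Reasoning

-- If `Q` held at 0, ..., F, two of these numbers would have the same code; as `Q` is decidable, a
-- counterexample can be found by search.
some-fails : ∀ {F} (Q : ℕ → Set) → Decidable₁ Q → (code : ∀ z → Q z → Fin F) →
  (∀ {z z′} (q : Q z) (q′ : Q z′) → code z q ≡ code z′ q′ → z ≡ z′) → ∃ λ z → ¬ Q z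
some-fails {F} Q Q? code code-injective =
  let z , ¬q = Fin.¬∀⟶∃¬ (suc F) (Q ∘ toℕ) (Q? ∘ toℕ) λ all →
        let i , j , i<j , eq = Fin.pigeonhole (n<1+n F) (λ z → code (toℕ z) (all z))
        in <⇒≢ i<j (code-injective (all i) (all j) eq)
  in toℕ z , ¬q

record Hard (P : Protocol) (n D c r W : ℕ) : Set₁ where
  field
    graph         : Digraph n
    operations    : Broadcasts n r
    eccentricity  : MaxEccentricity graph D
    inDegree      : MaxInDegree graph 2
    congested     : Congestion graph operations c
    slow          : ∀ T → CompletedWithin P graph operations T → c ≤ T × W < T

module _ (P : Protocol) {n : ℕ} (s d : Fin n) (s≢d : s ≢ d) (D c r : ℕ) (D≥2 : 2 ≤ D) (c≥1 : 1 ≤ c) (c≤r : c ≤ r) where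
  open Protocol P

  ops : ℕ → Broadcasts n r
  ops z = broadcasts s d c r z

  module _ {Good : ℕ → Levelling n → Fin n → Fin n → Set}
    (lev : Levelling n) (tower : Towers.Tower s d s≢d D Good D lev) (z : ℕ) {H : Message → Set} (H? : Decidable₁ H) where
    open Towers s d s≢d D Good
    open Tower tower
    open TowerGraph s d s≢d D D≥2 lev tower using (G; in-neighbours)

    CompatibleLayer : ∀ {i} → ℕ → Layer lev i → Set
    CompatibleLayer t L = Compatible (classify H? (action P (layered D before) (ops z) t left))
                                     (classify H? (action P (layered D before) (ops z) t right))
      where open Layer L

    -- Compatibility was observed under the levelling `before`; `action-local` carries it over to
    -- the final one.
    layer-unheard : ∀ {v i t m} → lev v ≡ suc (suc i) → (si<D : suc i < D) →
      CompatibleLayer t (layer i (<⇒≤ si<D)) →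
      hears G (action P G (ops z) t) v ≡ just m → ¬ H m
    layer-unheard {t = t} lv si<D compat = compatible⇒unheard H? G (action P G (ops z) t) distinct (in-neighbours lv si<D)
      (subst₂ (λ x y → Compatible (classify H? x) (classify H? y))
        (action-local P D before lev (ops z) agrees left-before (Equivalence.from (members left) (inj₁ refl)) t)
        (action-local P D before lev (ops z) agrees right-before (Equivalence.from (members right) (inj₂ refl)) t)
        compat)
      where open Layer (layer _ (<⇒≤ si<D))

  module Throughput (κ : ℕ) (enough : c * (2 * (2 * c)) ^ κ + 2 * D < n) where

    carries? : ∀ i m → Dec (recover m ≡ just i)
    carries? i m = Maybe.≡-dec _≟_ (recover m) (just i)

    symbol : Levelling n → ℕ → Fin n → ℕ → Symbol
    symbol lev i u t = classify (carries? i) (action P (layered D lev) (ops 0) t u)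

    symbol-unique : ∀ lev u t i j → symbol lev i u t ≡ hit → symbol lev j u t ≡ hit → i ≡ j
    symbol-unique lev u t i j p q with classify-hit⁻ (carries? i) (action P (layered D lev) (ops 0) t u) p
                                     | classify-hit⁻ (carries? j) (action P (layered D lev) (ops 0) t u) q
    ... | m , eq , ri | m′ , eq′ , rj with trans (sym eq) eq′
    ...   | refl = Maybe.just-injective (trans (sym ri) rj)

    -- Which message is blocked depends on the protocol and is known only when the pair is picked.
    Good : ℕ → Levelling n → Fin n → Fin n → Set
    Good j lev a b = ∃ λ i → i < c × (∀ t → t < c * κ → Compatible (symbol lev i a t) (symbol lev i b t))

    open Towers s d s≢d D Good

    pick : Pick
    pick j lev pool j<D pool! size =
      let i , i<c , a , b , a∈ , b∈ , a≢b , compat =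
            -- 1 + `β` = 2 c, so that a hit has probability 1 / 2c.
            compatible-for-some (symbol lev) (λ u t i j → symbol-unique lev u t i j) (pred (2 * c)) c κ
              (suc-pred (2 * c) {{>-nonZero (*-mono-≤ {1} {2} (s≤s z≤n) c≥1)}}) c≥1 pool pool! (pool-large enough j<D size)
      in a , b , a∈ , b∈ , a≢b , i , i<c , compat

    hard : Hard P n D c r (c * κ)
    hard with build pick (<⇒≤ D≥2)
    ... | lev , tower = record
      -- The IDs need not be secret: a guessed ID counts as a hit like any other.
      { graph = G ; operations = ops 0
      ; eccentricity = maxEccentricity ; inDegree = maxInDegree ; congested = congestion c r 0 c≤r
      ; slow = λ T done → congestion≤time c r 0 c≤r P T done ,
          not-yet P G (ops 0) (must-receive c r 0 c≤r lv D≥2 m m<c) (unheard⇒¬received P G (ops 0) (c * κ) unheard) done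
      }
      where
      open TowerGraph s d s≢d D D≥2 lev tower
      open Tower tower
      -- The first layer blocks message `i`, for which a node of level 2 is left waiting.
      open Layer (layer 0 (<⇒≤ D≥2))
      i = proj₁ good
      i<c = proj₁ (proj₂ good)
      v = proj₁ (occupied 2 D≥2)
      lv = proj₂ (occupied 2 D≥2)
      m : Fin r
      m = fromℕ< (<-≤-trans i<c c≤r)
      m≡i : toℕ m ≡ i
      m≡i = Fin.toℕ-fromℕ< (<-≤-trans i<c c≤r)
      m<c : toℕ m < c
      m<c = subst (_< c) (sym m≡i) i<c
      unheard : ∀ t → t < c * κ → ∀ x → hears G (action P G (ops 0) t) v ≡ just x → recover x ≢ just (toℕ m)
      unheard t t<cκ x heard rec = layer-unheard lev tower 0 (carries? i) lv D≥2 (proj₂ (proj₂ good) t t<cκ) heard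
        (trans rec (cong just m≡i))

  module Delay (w : ℕ) (enough : 2 ^ w + 2 * D < n) where

    anything? : ∀ (m : Message) → Dec ⊤
    anything? _ = yes tt

    symbol : ℕ → Levelling n → Fin n → ℕ → Symbol
    symbol z lev u t = classify anything? (action P (layered D lev) (ops z) t u)

    -- Every transmission is a hit here, so throughout the window from j w to (j + 1) w the two
    -- nodes either both transmit or both listen, and level j + 2 hears nothing.
    Good : ℕ → ℕ → Levelling n → Fin n → Fin n → Set
    Good z j lev a b = ∀ t → t < w → Compatible (symbol z lev a (j * w + t)) (symbol z lev b (j * w + t))

    module T z = Towers s d s≢d D (Good z)

    pick : ∀ z → T.Pick z
    -- For `β` = 1 this is the pigeonhole principle for the 2^w transmission patterns in the window.
    pick z j lev pool j<D pool! size = Kraft.kraft 1 (λ u t → symbol z lev u (j * w + t)) w pool pool!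
      (<-≤-trans (pool-large enough j<D size) (length≤total _ pool w))

    levels : ∀ z → ∃ (T.Tower z D)
    levels z = T.build z (pick z) (<⇒≤ D≥2)

    quiet : ∀ z lev → T.Tower z D lev → ∀ {v j t} → lev v ≡ suc (suc j) → suc j < D → j * w ≤ t → t < suc j * w →
      hears (layered D lev) (action P (layered D lev) (ops z) t) v ≡ nothing
    quiet z lev tower {v} {j} {t} lv sj<D lo hi
      with hears (layered D lev) (action P (layered D lev) (ops z) t) v in eq
    ... | nothing = refl
    ... | just m  = contradiction tt (layer-unheard lev tower z anything? lv sj<D
      (subst (λ t → Compatible (symbol z before left t) (symbol z before right t)) (m+[n∸m]≡n lo)
        (good (t ∸ j * w) (+-cancelˡ-< (j * w) _ _ (subst₂ _<_ (sym (m+[n∸m]≡n lo)) (+-comm w (j * w)) hi)))) eq)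
      where open T.Layer z (T.Tower.layer tower j (<⇒≤ sj<D))

    -- Before slot j w, a node of level 1 + j cannot tell the message IDs of the two runs apart.
    indistinguishable : ∀ z z′ lev lev′ → T.Tower z D lev → T.Tower z′ D lev′ → (∀ x → lev x ≡ lev′ x) →
      ∀ {v j} → lev v ≡ suc j → j < D →
      history P (layered D lev) (ops z) (j * w) v ≡ history P (layered D lev′) (ops z′) (j * w) v
    indistinguishable z z′ lev lev′ tower tower′ lev≗ {v} {j} lv j<D =
      history-cong P (layered D lev) (layered D lev′) (ops z) (ops z′) K own≡ step (j * w) {v} (j , lv , j<D , ≤-refl)
      where
      K : ℕ → Fin n → Set
      K t v = ∃ λ j → lev v ≡ suc j × j < D × t ≤ j * w
      own≡ : ∀ {t v} → K t v → Broadcasts.own (ops z) v ≡ Broadcasts.own (ops z′) v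
      own≡ {v = v} (j , lv , j<D , _) = trans (TowerGraph.own-layer s d s≢d D D≥2 lev tower c r z c≤r lv j<D)
        (sym (TowerGraph.own-layer s d s≢d D D≥2 lev′ tower′ c r z′ c≤r (trans (sym (lev≗ v)) lv) j<D))
      step : ∀ {t v} → K (suc t) v → K t v ×
        (hears (layered D lev) (action P (layered D lev) (ops z) t) v ≡ hears (layered D lev′) (action P (layered D lev′) (ops z′) t) v
         ⊎ (∀ u → Digraph._⟶_ (layered D lev) u v ⇔ Digraph._⟶_ (layered D lev′) u v) × (∀ u → Digraph._⟶_ (layered D lev) u v → K t u))
      -- A node of level 1 is in `K` at slot 0 only. A node of level j + 2 hears nothing in its last
      -- window, in either run; before that window its in-neighbours are still in `K`.
      step {t} {v} (suc j , lv , j<D , t<) with j * w ≤? t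
      ... | yes lo = (suc j , lv , j<D , <⇒≤ t<) , inj₁ (trans (quiet z lev tower lv j<D lo t<)
                       (sym (quiet z′ lev′ tower′ (trans (sym (lev≗ v)) lv) j<D lo t<)))
      ... | no ¬lo = (suc j , lv , j<D , <⇒≤ t<) , inj₂ (
        (λ u → mk⇔ (λ (e , l) → trans (cong suc (sym (lev≗ u))) (trans e (lev≗ v)) , subst (_≤ D) (lev≗ v) l)
                   (λ (e , l) → trans (cong suc (lev≗ u)) (trans e (sym (lev≗ v))) , subst (_≤ D) (sym (lev≗ v)) l)) ,
        λ u (e , _) → j , suc-injective (trans e lv) , <⇒≤ j<D , <⇒≤ (≰⇒> ¬lo))

    module _ (D′ : ℕ) (D≡ : D ≡ suc D′) where

      W : ℕ
      W = D′ * w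

      D′<D : D′ < D
      D′<D = subst (D′ <_) (sym D≡) ≤-refl

      target : ∀ z → ∃ λ v → proj₁ (levels z) v ≡ suc D′
      target z = TowerGraph.occupied s d s≢d D D≥2 (proj₁ (levels z)) (proj₂ (levels z)) (suc D′) D′<D

      -- The ID of the first operation is z + 0. Receiving it this early amounts to a lucky guess by
      -- the protocol.
      Received : ℕ → Set
      Received z = ReceivedWithin P (layered D (proj₁ (levels z))) (ops z) W (proj₁ (target z)) z

      levelCode : ℕ → Fin n → Fin (suc (suc D))
      levelCode z x = fromℕ< (s≤s (T.Tower.bounded (proj₂ (levels z)) x))

      -- Runs with the same code hear the same transmission in the same slot at the target, and it
      -- contains a single broadcast message.
      code : ∀ z → Received z → Fin (suc (suc D) ^ n * (n * W))
      code z rec = combine (funToFin (levelCode z)) (combine (proj₁ (target z)) (VecAny.index rec))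

      code-levels : ∀ z z′ → funToFin (levelCode z) ≡ funToFin (levelCode z′) → ∀ x → proj₁ (levels z) x ≡ proj₁ (levels z′) x
      code-levels z z′ eq x = begin
        proj₁ (levels z) x    ≡⟨ sym (Fin.toℕ-fromℕ< _) ⟩
        toℕ (levelCode z x)   ≡⟨ cong toℕ (sym (Fin.finToFun-funToFin (levelCode z) x)) ⟩
        toℕ (finToFun (funToFin (levelCode z)) x)   ≡⟨ cong (λ f → toℕ (finToFun f x)) eq ⟩
        toℕ (finToFun (funToFin (levelCode z′)) x)  ≡⟨ cong toℕ (Fin.finToFun-funToFin (levelCode z′) x) ⟩
        toℕ (levelCode z′ x)  ≡⟨ Fin.toℕ-fromℕ< _ ⟩
        proj₁ (levels z′) x   ∎
        where open ≡-Reasoning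

      same-message : ∀ {z z′} {h h′ : Vec (Maybe Message) W}
        (p : VecAny.Any (MaybeAny.Any (λ m → recover m ≡ just z)) h) (p′ : VecAny.Any (MaybeAny.Any (λ m → recover m ≡ just z′)) h′) →
        h ≡ h′ → VecAny.index p ≡ VecAny.index p′ → z ≡ z′
      same-message p p′ refl = index-injective P recover p p′

      code-injective : ∀ z z′ (rec : Received z) (rec′ : Received z′) → code z rec ≡ code z′ rec′ → z ≡ z′
      code-injective z z′ rec rec′ eq =
        let levels≡ , rest≡ = Fin.combine-injective (funToFin (levelCode z)) _ (funToFin (levelCode z′)) _ eq
            target≡ , index≡ = Fin.combine-injective (proj₁ (target z)) _ (proj₁ (target z′)) _ rest≡
        in same-message rec rec′
             (trans (indistinguishable z z′ _ _ (proj₂ (levels z)) (proj₂ (levels z′)) (code-levels z z′ levels≡) (proj₂ (target z)) D′<D)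
                    (cong (history P (layered D (proj₁ (levels z′))) (ops z′) W) target≡))
             index≡

      unguessed : ∃ λ z → ¬ Received z
      unguessed =
        some-fails Received (λ z → received? P (layered D (proj₁ (levels z))) (ops z) W (proj₁ (target z)) z)
          code (λ {z} {z′} → code-injective z z′)

      hard-for : ∀ z → ¬ Received z → Hard P n D c r W
      hard-for z ¬rec = record
        { graph = G ; operations = ops z
        ; eccentricity = maxEccentricity ; inDegree = maxInDegree ; congested = congestion c r z c≤r
        ; slow = λ T done → congestion≤time c r z c≤r P T done ,
            not-yet P G (ops z) (must-receive c r z c≤r (proj₂ (target z)) D′<D m (subst (_< c) (sym m≡0) c≥1))
              (¬rec ∘ subst (ReceivedWithin P G (ops z) W (proj₁ (target z))) (trans (cong (z +_) m≡0) (+-identityʳ z))) done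
        }
        where
        open TowerGraph s d s≢d D D≥2 (proj₁ (levels z)) (proj₂ (levels z))
        m : Fin r
        m = fromℕ< (≤-trans c≥1 c≤r)
        m≡0 : toℕ m ≡ 0
        m≡0 = Fin.toℕ-fromℕ< (≤-trans c≥1 c≤r)

      hard : Hard P n D c r W
      hard = hard-for (proj₁ unguessed) (proj₂ unguessed)

-- Logarithms and parameters

toℚᵘ-fromℕ : ∀ k → ℚ.toℚᵘ (fromℕ k) ℚᵘ.≃ mkℚᵘ (ℤ.+ k) 0
toℚᵘ-fromℕ k = ℚ.toℚᵘ-fromℚᵘ (mkℚᵘ (ℤ.+ k) 0)

fromℕ-mono-≤ : ∀ {m n} → m ≤ n → fromℕ m ℚ.≤ fromℕ n
fromℕ-mono-≤ {m} {n} m≤n = ℚ.toℚᵘ-cancel-≤ (begin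
  ℚ.toℚᵘ (fromℕ m)  ≃⟨ toℚᵘ-fromℕ m ⟩
  mkℚᵘ (ℤ.+ m) 0    ≤⟨ *≤* (ℤ.*-monoʳ-≤-nonNeg (ℤ.+ 1) (ℤ.+≤+ m≤n)) ⟩
  mkℚᵘ (ℤ.+ n) 0    ≃⟨ ℚᵘ.≃-sym (toℚᵘ-fromℕ n) ⟩
  ℚ.toℚᵘ (fromℕ n)  ∎)
  where open ℚᵘ.≤-Reasoning

fromℕ-* : ∀ m n → fromℕ (m * n) ≡ fromℕ m ℚ.* fromℕ n
fromℕ-* m n = ℚ.toℚᵘ-injective (begin-equality
  ℚ.toℚᵘ (fromℕ (m * n))            ≃⟨ toℚᵘ-fromℕ (m * n) ⟩
  mkℚᵘ (ℤ.+ (m * n)) 0              ≃⟨ ℚᵘ.*≡* (cong (ℤ._* ℤ.+ 1) (ℤ.pos-* m n)) ⟩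
  mkℚᵘ (ℤ.+ m) 0 ℚᵘ.* mkℚᵘ (ℤ.+ n) 0    ≃⟨ ℚᵘ.≃-sym (ℚᵘ.*-cong (toℚᵘ-fromℕ m) (toℚᵘ-fromℕ n)) ⟩
  ℚ.toℚᵘ (fromℕ m) ℚᵘ.* ℚ.toℚᵘ (fromℕ n) ≃⟨ ℚᵘ.≃-sym (ℚ.toℚᵘ-homo-* (fromℕ m) (fromℕ n)) ⟩
  ℚ.toℚᵘ (fromℕ m ℚ.* fromℕ n)          ∎)
  where open ℚᵘ.≤-Reasoning

fromℕ-+ : ∀ m n → fromℕ (m + n) ≡ fromℕ m ℚ.+ fromℕ n
fromℕ-+ m n = ℚ.toℚᵘ-injective (begin-equality
  ℚ.toℚᵘ (fromℕ (m + n))            ≃⟨ toℚᵘ-fromℕ (m + n) ⟩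
  mkℚᵘ (ℤ.+ (m + n)) 0              ≃⟨ ℚᵘ.*≡* (cong (ℤ._* ℤ.+ 1) (trans (ℤ.pos-+ m n) (sym (cong₂ ℤ._+_ (ℤ.*-identityʳ (ℤ.+ m)) (ℤ.*-identityʳ (ℤ.+ n)))))) ⟩
  mkℚᵘ (ℤ.+ m) 0 ℚᵘ.+ mkℚᵘ (ℤ.+ n) 0    ≃⟨ ℚᵘ.≃-sym (ℚᵘ.+-cong (toℚᵘ-fromℕ m) (toℚᵘ-fromℕ n)) ⟩
  ℚ.toℚᵘ (fromℕ m) ℚᵘ.+ ℚ.toℚᵘ (fromℕ n) ≃⟨ ℚᵘ.≃-sym (ℚ.toℚᵘ-homo-+ (fromℕ m) (fromℕ n)) ⟩
  ℚ.toℚᵘ (fromℕ m ℚ.+ fromℕ n)          ∎)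
  where open ℚᵘ.≤-Reasoning

fromℕ-nonNeg : ∀ k → ℚ.NonNegative (fromℕ k)
fromℕ-nonNeg k = ℚ.nonNegative (fromℕ-mono-≤ {0} {k} z≤n)

-- For `s` = p / q, compare exponents in 2^(l q) ≤ c^q ≤ 2^p.
≤-log₂ : ∀ {l c} (s : ℚ) .{{_ : Positive s}} → 2 ^ l ≤ c → log₂ c ≤ᵘ s → fromℕ l ℚ.≤ s
≤-log₂ {l} {c} s@(mkℚ (ℤ.+ p) q-1 _) 2^l≤c c^q≤2^p = ℚ.toℚᵘ-cancel-≤ (begin
  ℚ.toℚᵘ (fromℕ l)  ≃⟨ toℚᵘ-fromℕ l ⟩
  mkℚᵘ (ℤ.+ l) 0    ≤⟨ *≤* (subst₂ ℤ._≤_ (ℤ.pos-* l (suc q-1)) (sym (ℤ.*-identityʳ (ℤ.+ p))) (ℤ.+≤+ lq≤p)) ⟩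
  ℚ.toℚᵘ s          ∎)
  where
  open ℚᵘ.≤-Reasoning
  lq≤p : l * suc q-1 ≤ p
  lq≤p = ≮⇒≥ λ p<lq → <⇒≱ (^-monoʳ-< 2 (s≤s (s≤s z≤n)) p<lq)
    (≤-trans (≤-reflexive (sym (^-*-assoc 2 l (suc q-1)))) (≤-trans (^-monoˡ-≤ (suc q-1) 2^l≤c) c^q≤2^p))

log₂-≤ : ∀ {k n} (t : ℚ) .{{_ : Positive t}} → n ≤ 2 ^ k → t ≤ˡlog₂ n → t ℚ.≤ fromℕ k
log₂-≤ {k} {n} t@(mkℚ (ℤ.+ p) q-1 _) n≤2^k 2^p≤n^q = ℚ.toℚᵘ-cancel-≤ (begin
  ℚ.toℚᵘ t          ≤⟨ *≤* (subst₂ ℤ._≤_ (sym (ℤ.*-identityʳ (ℤ.+ p))) (ℤ.pos-* k (suc q-1)) (ℤ.+≤+ p≤kq)) ⟩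
  mkℚᵘ (ℤ.+ k) 0    ≃⟨ ℚᵘ.≃-sym (toℚᵘ-fromℕ k) ⟩
  ℚ.toℚᵘ (fromℕ k)  ∎)
  where
  open ℚᵘ.≤-Reasoning
  p≤kq : p ≤ k * suc q-1
  p≤kq = ≮⇒≥ λ kq<p → <⇒≱ (^-monoʳ-< 2 (s≤s (s≤s z≤n)) kq<p)
    (≤-trans 2^p≤n^q (≤-trans (^-monoˡ-≤ (suc q-1) n≤2^k) (≤-reflexive (^-*-assoc 2 k (suc q-1)))))

÷⁺-* : ∀ x s .{{_ : Positive s}} → (x ÷⁺ s) ℚ.* s ≡ x
÷⁺-* x s = trans (ℚ.*-assoc x _ s) (trans (cong (x ℚ.*_) (ℚ.*-inverseˡ s {{ℚ.pos⇒nonZero s}})) (ℚ.*-identityʳ x))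

-- The three summands of the bound are at most `T`, 12 T and 12 T, and 1 + 12 + 12 = 25.
rate : ℚ
rate = ℤ.+ 1 ℚ./ 25

timeBound : ∀ {n D c T k l} → 2 ^ l ≤ c → n ≤ 2 ^ k →
  c ≤ T → c * k ≤ 12 * T * l → D * k ≤ 12 * T → TimeBound rate n D c T
timeBound {n} {D} {c} {T} {k} {l} 2^l≤c n≤2^k c≤T ck≤12Tl Dk≤12T s t s≥ t≤ = begin
  a ℚ.* (fromℕ c ℚ.+ (y ℚ.+ fromℕ D) ℚ.* t)         ≡⟨ cong (λ x → a ℚ.* (fromℕ c ℚ.+ x)) (ℚ.*-distribʳ-+ t y (fromℕ D)) ⟩
  a ℚ.* (fromℕ c ℚ.+ (y ℚ.* t ℚ.+ fromℕ D ℚ.* t))     ≤⟨ ℚ.*-monoˡ-≤-nonNeg a (ℚ.+-mono-≤ (fromℕ-mono-≤ c≤T) (ℚ.+-mono-≤ yt≤12T Dt≤12T)) ⟩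
  a ℚ.* (fromℕ T ℚ.+ (fromℕ (12 * T) ℚ.+ fromℕ (12 * T))) ≡⟨ cong (λ x → a ℚ.* (fromℕ T ℚ.+ x)) (sym (fromℕ-+ (12 * T) (12 * T))) ⟩
  a ℚ.* (fromℕ T ℚ.+ fromℕ (12 * T + 12 * T))  ≡⟨ cong (a ℚ.*_) (sym (fromℕ-+ T (12 * T + 12 * T))) ⟩
  a ℚ.* fromℕ (T + (12 * T + 12 * T)) ≡⟨ cong (λ x → a ℚ.* fromℕ (T + x)) (sym (*-distribʳ-+ T 12 12)) ⟩
  a ℚ.* fromℕ (25 * T)                      ≡⟨ cong (a ℚ.*_) (fromℕ-* 25 T) ⟩
  a ℚ.* (fromℕ 25 ℚ.* fromℕ T)                  ≡⟨ sym (ℚ.*-assoc a (fromℕ 25) (fromℕ T)) ⟩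
  a ℚ.* fromℕ 25 ℚ.* fromℕ T                    ≡⟨ ℚ.*-identityˡ (fromℕ T) ⟩
  fromℕ T                                   ∎
  where
  open ℚ.≤-Reasoning
  a y : ℚ
  a = rate
  y = fromℕ c ÷⁺ s
  t≤k : t ℚ.≤ fromℕ k
  t≤k = log₂-≤ {k} t n≤2^k t≤
  instance
    c≥0 : ℚ.NonNegative (fromℕ c)
    c≥0 = fromℕ-nonNeg c
    D≥0 : ℚ.NonNegative (fromℕ D)
    D≥0 = fromℕ-nonNeg D
    12T≥0 : ℚ.NonNegative (fromℕ (12 * T))
    12T≥0 = fromℕ-nonNeg (12 * T)
  Dt≤12T : fromℕ D ℚ.* t ℚ.≤ fromℕ (12 * T)
  Dt≤12T = begin
    fromℕ D ℚ.* t         ≤⟨ ℚ.*-monoˡ-≤-nonNeg (fromℕ D) t≤k ⟩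
    fromℕ D ℚ.* fromℕ k   ≡⟨ sym (fromℕ-* D k) ⟩
    fromℕ (D * k)     ≤⟨ fromℕ-mono-≤ Dk≤12T ⟩
    fromℕ (12 * T)    ∎
  yt≤12T : y ℚ.* t ℚ.≤ fromℕ (12 * T)
  yt≤12T = ℚ.*-cancelʳ-≤-pos s (begin
    y ℚ.* t ℚ.* s                  ≡⟨ trans (ℚ.*-assoc y t s) (trans (cong (y ℚ.*_) (ℚ.*-comm t s)) (sym (ℚ.*-assoc y s t))) ⟩
    y ℚ.* s ℚ.* t                  ≡⟨ cong (ℚ._* t) (÷⁺-* (fromℕ c) s) ⟩
    fromℕ c ℚ.* t                ≤⟨ ℚ.*-monoˡ-≤-nonNeg (fromℕ c) t≤k ⟩
    fromℕ c ℚ.* fromℕ k          ≡⟨ sym (fromℕ-* c k) ⟩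
    fromℕ (c * k)            ≤⟨ fromℕ-mono-≤ ck≤12Tl ⟩
    fromℕ (12 * T * l)     ≡⟨ fromℕ-* (12 * T) l ⟩
    fromℕ (12 * T) ℚ.* fromℕ l ≤⟨ ℚ.*-monoˡ-≤-nonNeg (fromℕ (12 * T)) (≤-log₂ {l} s 2^l≤c s≥) ⟩
    fromℕ (12 * T) ℚ.* s       ∎)

log≥1 : ∀ {c l} → 2 ≤ c → c < 2 ^ suc l → 1 ≤ l
log≥1 {l = zero}  2≤c c<2 = contradiction 2≤c (<⇒≱ c<2)
log≥1 {l = suc l} _   _   = s≤s z≤n

log≥4 : ∀ {n k} → 16 ≤ n → n < 2 ^ suc k → 4 ≤ k
log≥4 {n} {k} 16≤n n< = ≮⇒≥ λ k<4 → <⇒≱ n< (≤-trans (^-monoʳ-≤ 2 k<4) 16≤n)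

-- The candidates take at most n / 2 and the layers at most n / 3, which leaves a sixth of the
-- nodes.
room : ∀ {n D w} → 3 ≤ D → 6 * D ≤ n → 2 ^ suc w ≤ n → 2 ^ w + 2 * D < n
room {n} {D} {w} 3≤D 6D≤n 2^≤n = *-cancelˡ-< 6 _ _ (begin-strict
  6 * (2 ^ w + 2 * D)          ≡⟨ lemma (2 ^ w) D ⟩
  3 * 2 ^ suc w + 2 * (6 * D)  ≤⟨ +-mono-≤ (*-monoʳ-≤ 3 2^≤n) (*-monoʳ-≤ 2 6D≤n) ⟩
  3 * n + 2 * n                ≡⟨ sym (*-distribʳ-+ n 3 2) ⟩
  5 * n                        <⟨ *-monoˡ-< n {{>-nonZero (≤-trans (s≤s z≤n) (≤-trans (*-monoʳ-≤ 6 3≤D) 6D≤n))}} {5} {6} ≤-refl ⟩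
  6 * n                        ∎)
  where
  open ≤-Reasoning
  lemma : ∀ x D → 6 * (x + 2 * D) ≡ 3 * (2 * x) + 2 * (6 * D)
  lemma = solve-∀

-- Replacing each factor on the left by its counterpart in D′ w costs at most 2, hence 4 in all; 12
-- is the constant of the throughput bound.
delay-bound : ∀ {D′ w T} → 2 ≤ D′ → 3 ≤ suc w → D′ * w < T → suc D′ * suc (suc w) ≤ 12 * T
delay-bound {D′} {w} {T} 2≤D′ 3≤sw W<T = begin
  suc D′ * suc (suc w)          ≤⟨ *-mono-≤ (+-monoˡ-≤ D′ (≤-trans (s≤s z≤n) 2≤D′)) (+-monoˡ-≤ w (≤-pred 3≤sw)) ⟩
  (D′ + D′) * (w + w)           ≡⟨ lemma D′ w ⟩
  4 * (D′ * w)                  ≤⟨ *-mono-≤ {4} {12} (s≤s (s≤s (s≤s (s≤s z≤n)))) (<⇒≤ W<T) ⟩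
  12 * T                        ∎
  where
  open ≤-Reasoning
  lemma : ∀ d w → (d + d) * (w + w) ≡ 4 * (d * w)
  lemma = solve-∀

-- The largest κ for which 2^(l + 1) · 2^((l + 3) κ) ≤ 2^w.
throughput-exponent : ∀ {l w} → 1 ≤ l → 8 * l < suc (suc w) →
  ∃ λ κ → suc l + (3 + l) * κ ≤ w × suc (suc w) ≤ 12 * (l * κ)
throughput-exponent {l} {w} 1≤l 8l<k = κ , fits , large
  where
  open ≤-Reasoning
  q κ : ℕ
  q = w ∸ suc l
  κ = q / (3 + l)
  split : suc l + q ≡ w
  split = m+[n∸m]≡n (≤-pred (≤-pred (begin
    3 + l           ≤⟨ +-monoˡ-≤ l (*-monoʳ-≤ 3 1≤l) ⟩
    3 * l + l       ≡⟨ +-comm (3 * l) l ⟩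
    4 * l           ≤⟨ *-monoˡ-≤ l {4} {8} (m≤m+n 4 4) ⟩
    8 * l           ≤⟨ <⇒≤ 8l<k ⟩
    suc (suc w)     ∎)))
  fits : suc l + (3 + l) * κ ≤ w
  fits = begin
    suc l + (3 + l) * κ   ≡⟨ cong (suc l +_) (*-comm (3 + l) κ) ⟩
    suc l + κ * (3 + l)   ≤⟨ +-monoʳ-≤ (suc l) (m/n*n≤m q (3 + l)) ⟩
    suc l + q             ≡⟨ split ⟩
    w                     ∎
  -- The remainder is below l + 3, and l + 3 ≤ 4 l.
  upper : suc (suc w) ≤ 4 * l * (2 + κ)
  upper = begin
    suc (suc w)                          ≡⟨ cong (λ x → suc (suc x)) (trans (sym split) (cong (suc l +_) (m≡m%n+[m/n]*n q (3 + l)))) ⟩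
    suc (suc (suc l + (q % (3 + l) + κ * (3 + l))))  ≡⟨ l₁ l (q % (3 + l)) (κ * (3 + l)) ⟩
    2 + l + (suc (q % (3 + l)) + κ * (3 + l))  ≤⟨ +-mono-≤ (n≤1+n (2 + l)) (+-monoˡ-≤ _ (m%n<n q (3 + l))) ⟩
    3 + l + (3 + l + κ * (3 + l))        ≤⟨ *-monoʳ-≤ (2 + κ) (+-monoˡ-≤ l (*-monoʳ-≤ 3 1≤l)) ⟩
    (2 + κ) * (3 * l + l)                ≡⟨ l₂ κ l ⟩
    4 * l * (2 + κ)                      ∎
    where
    l₁ : ∀ l r x → suc (suc (suc l + (r + x))) ≡ 2 + l + (suc r + x)
    l₁ = solve-∀
    l₂ : ∀ κ l → (2 + κ) * (3 * l + l) ≡ 4 * l * (2 + κ)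
    l₂ = solve-∀
  -- The 8 in the hypothesis makes `κ` nonzero: 8 l < 4 l (2 + κ).
  κ>0 : 1 ≤ κ
  κ>0 = ≤-pred (≤-pred (*-cancelˡ-< (4 * l) 2 (2 + κ) (begin-strict
    4 * l * 2         ≡⟨ trans (*-comm (4 * l) 2) (sym (*-assoc 2 4 l)) ⟩
    8 * l             <⟨ 8l<k ⟩
    suc (suc w)       ≤⟨ upper ⟩
    4 * l * (2 + κ)   ∎)))
  -- Since 2 + κ ≤ 3 κ, the constant is 4 · 3.
  large : suc (suc w) ≤ 12 * (l * κ)
  large = begin
    suc (suc w)            ≤⟨ upper ⟩
    4 * l * (2 + κ)        ≤⟨ *-monoʳ-≤ (4 * l) (+-monoˡ-≤ κ (*-monoʳ-≤ 2 κ>0)) ⟩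
    4 * l * (2 * κ + κ)    ≡⟨ lemma l κ ⟩
    12 * (l * κ)           ∎
    where
    lemma : ∀ l κ → 4 * l * (2 * κ + κ) ≡ 12 * (l * κ)
    lemma = solve-∀

-- Because 4 c ≤ 2^(l + 3), both adversaries get by with the same number of candidates.
throughput-room : ∀ {c l w κ} → c < 2 ^ suc l → suc l + (3 + l) * κ ≤ w → c * (2 * (2 * c)) ^ κ ≤ 2 ^ w
throughput-room {c} {l} {w} {κ} c< fits = begin
  c * (2 * (2 * c)) ^ κ                         ≤⟨ *-mono-≤ (<⇒≤ c<) (^-monoˡ-≤ κ (*-monoʳ-≤ 2 (*-monoʳ-≤ 2 (<⇒≤ c<)))) ⟩
  2 ^ suc l * (2 ^ (3 + l)) ^ κ                 ≡⟨ cong (2 ^ suc l *_) (^-*-assoc 2 (3 + l) κ) ⟩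
  2 ^ suc l * 2 ^ ((3 + l) * κ)                 ≡⟨ sym (^-distribˡ-+-* 2 (suc l) ((3 + l) * κ)) ⟩
  2 ^ (suc l + (3 + l) * κ)                     ≤⟨ ^-monoʳ-≤ 2 fits ⟩
  2 ^ w                                         ∎
  where open ≤-Reasoning

-- The two logarithmic terms of the bound without fractions, with `k` ≥ log₂ n in place of log₂ n
-- and `l` ≤ log₂ c in place of log₂ c.
record Dominates (n D c W : ℕ) : Set where
  field
    k l        : ℕ
    2^l≤c      : 2 ^ l ≤ c
    n≤2^k      : n ≤ 2 ^ k
    throughput : ∀ {T} → c ≤ T → W < T → c * k ≤ 12 * T * l
    delay      : ∀ {T} → c ≤ T → W < T → D * k ≤ 12 * T

dominates⇒timeBound : ∀ {n D c W T} → Dominates n D c W → c ≤ T → W < T → TimeBound rate n D c T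
dominates⇒timeBound {n} {D} {c} {T = T} dom c≤T W<T =
  timeBound {n} {D} {c} {T} {k} {l} 2^l≤c n≤2^k c≤T (throughput c≤T W<T) (delay c≤T W<T)
  where open Dominates dom

-- The choice between the two adversaries

module _ (P : Protocol) {n : ℕ} (s d : Fin n) (s≢d : s ≢ d) (D′ c r l w : ℕ)
  (2≤D′ : 2 ≤ D′) (6D≤n : 6 * suc D′ ≤ n) (2≤c : 2 ≤ c) (c≤r : c ≤ r)
  (2^l≤c : 2 ^ l ≤ c) (c< : c < 2 ^ suc l) (2^≤n : 2 ^ suc w ≤ n) (n< : n < 2 ^ suc (suc w)) where

  private
    D k : ℕ
    D = suc D′
    k = suc (suc w)

    D≥2 : 2 ≤ D
    D≥2 = m≤n⇒m≤1+n 2≤D′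

    space : 2 ^ w + 2 * D < n
    space = room {n} {D} {w} (s≤s 2≤D′) 6D≤n 2^≤n

    1≤l : 1 ≤ l
    1≤l = log≥1 {l = l} 2≤c c<

    3≤1+w : 3 ≤ suc w
    -- `n` is at least 6 · 3 = 18 and so at least 16.
    3≤1+w = ≤-trans (n≤1+n 3) (log≥4 {k = suc w} (≤-trans (m≤m+n 16 2) (≤-trans (*-monoʳ-≤ 6 (s≤s 2≤D′)) 6D≤n)) n<)

  -- The throughput term (c / l) k is at most D k in the first case and at most 8 c ≤ 8 T in the
  -- second.
  hard-by-delay : c ≤ D * l ⊎ k ≤ 8 * l → ∃ λ W → Hard P n D c r W × Dominates n D c W
  hard-by-delay few = D′ * w , Delay.hard P s d s≢d D c r D≥2 (<⇒≤ 2≤c) c≤r w space D′ refl , record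
    { k = k ; l = l ; 2^l≤c = 2^l≤c ; n≤2^k = <⇒≤ n<
    ; throughput = λ c≤T W<T → throughput few c≤T (delay W<T)
    ; delay      = λ _ → delay
    }
    where
    open ≤-Reasoning
    delay : ∀ {T} → D′ * w < T → D * k ≤ 12 * T
    delay = delay-bound 2≤D′ 3≤1+w
    throughput : c ≤ D * l ⊎ k ≤ 8 * l → ∀ {T} → c ≤ T → D * k ≤ 12 * T → c * k ≤ 12 * T * l
    throughput (inj₁ c≤Dl) {T} c≤T Dk≤12T = begin
      c * k            ≤⟨ *-monoˡ-≤ k c≤Dl ⟩
      D * l * k        ≡⟨ lemma D l k ⟩
      D * k * l        ≤⟨ *-monoˡ-≤ l Dk≤12T ⟩
      12 * T * l       ∎
      where lemma : ∀ D l k → D * l * k ≡ D * k * l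
            lemma = solve-∀
    throughput (inj₂ k≤8l) {T} c≤T _ = begin
      c * k            ≤⟨ *-mono-≤ c≤T (≤-trans k≤8l (*-monoˡ-≤ l {8} {12} (m≤m+n 8 4))) ⟩
      T * (12 * l)     ≡⟨ lemma T l ⟩
      12 * T * l       ∎
      where lemma : ∀ T l → T * (12 * l) ≡ 12 * T * l
            lemma = solve-∀

  -- Here `D` ≤ c / l, so the throughput term also bounds D k.
  hard-by-throughput : D * l ≤ c → (∃ λ κ → suc l + (3 + l) * κ ≤ w × k ≤ 12 * (l * κ)) →
    ∃ λ W → Hard P n D c r W × Dominates n D c W
  hard-by-throughput Dl≤c (κ , fits , large) = c * κ ,
    Throughput.hard P s d s≢d D c r D≥2 (<⇒≤ 2≤c) c≤r κ
      (≤-<-trans (+-monoˡ-≤ (2 * D) (throughput-room {c} {l} {w} {κ} c< fits)) space) , record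
    { k = k ; l = l ; 2^l≤c = 2^l≤c ; n≤2^k = <⇒≤ n<
    ; throughput = λ _ → throughput
    ; delay      = λ {T} _ W<T → delay {T} (throughput W<T)
    }
    where
    open ≤-Reasoning
    throughput : ∀ {T} → c * κ < T → c * k ≤ 12 * T * l
    throughput {T} cκ<T = begin
      c * k              ≤⟨ *-monoʳ-≤ c large ⟩
      c * (12 * (l * κ)) ≡⟨ lemma c l κ ⟩
      12 * (c * κ) * l   ≤⟨ *-monoˡ-≤ l (*-monoʳ-≤ 12 (<⇒≤ cκ<T)) ⟩
      12 * T * l         ∎
      where lemma : ∀ c l κ → c * (12 * (l * κ)) ≡ 12 * (c * κ) * l
            lemma = solve-∀
    delay : ∀ {T} → c * k ≤ 12 * T * l → D * k ≤ 12 * T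
    delay {T} ck≤ = *-cancelʳ-≤ (D * k) (12 * T) l {{>-nonZero 1≤l}} (begin
      D * k * l          ≡⟨ lemma D l k ⟩
      D * l * k          ≤⟨ *-monoˡ-≤ k Dl≤c ⟩
      c * k              ≤⟨ ck≤ ⟩
      12 * T * l         ∎)
      where lemma : ∀ D l k → D * k * l ≡ D * l * k
            lemma = solve-∀

  -- The delay instance is used when D outweighs c / log₂ c or when c dominates anyway.
  hard-instance : ∃ λ W → Hard P n D c r W × Dominates n D c W
  hard-instance = case (c ≤? D * l) ⊎-dec (k ≤? 8 * l) of λ where
    (yes few) → hard-by-delay few
    (no many) → hard-by-throughput (<⇒≤ (≰⇒> (many ∘ inj₁)))
      (throughput-exponent 1≤l (≰⇒> (many ∘ inj₂)))

theorem5p2 : ∃ λ (a : ℚ) → 0ℚ <ℚ a ×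
    ((P : Protocol) (n D c r : ℕ) →
    4 ≤ n → 3 ≤ D → 6 * D ≤ n → 2 ≤ c → c ≤ r →
    Σ (Digraph n) λ G → Σ (Broadcasts n r) λ B →
    MaxEccentricity G D ×
    MaxInDegree G 2 ×
    Congestion G B c ×
    (∀ T → CompletionTime P G B T → TimeBound a n D c T))
theorem5p2 = rate , ℚ.positive⁻¹ rate , main
  where
  main : ∀ P n D c r → 4 ≤ n → 3 ≤ D → 6 * D ≤ n → 2 ≤ c → c ≤ r →
    Σ (Digraph n) λ G → Σ (Broadcasts n r) λ B →
    MaxEccentricity G D × MaxInDegree G 2 × Congestion G B c ×
    (∀ T → CompletionTime P G B T → TimeBound rate n D c T)
  main P (suc zero) (suc D′) c r (s≤s ())
  main P n@(suc (suc _)) (suc D′) c r 4≤n (s≤s 2≤D′) 6D≤n 2≤c c≤r =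
    let l , 2^l≤c , c< = floorLog c (<⇒≤ 2≤c)
        k , 2^k≤n , n< = floorLog n (≤-trans (s≤s z≤n) 4≤n)
        W , hard , dominates = instance-for k 2^k≤n n< l 2^l≤c c<
        open Hard hard
    in graph , operations , eccentricity , inDegree , congested , λ T (done , _) →
       dominates⇒timeBound dominates (proj₁ (slow T done)) (proj₂ (slow T done))
    where
    instance-for : ∀ k → 2 ^ k ≤ n → n < 2 ^ suc k → ∀ l → 2 ^ l ≤ c → c < 2 ^ suc l →
      ∃ λ W → Hard P n (suc D′) c r W × Dominates n (suc D′) c W
    instance-for zero    _     n<  = contradiction (≤-trans (s≤s (s≤s z≤n)) 4≤n) (<⇒≱ n<)
    instance-for (suc w) 2^k≤n n< l 2^l≤c c< = hard-instance P zero (suc zero) (λ ()) D′ c r l w 2≤D′ 6D≤n 2≤c c≤r 2^l≤c c< 2^k≤n n<
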